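{- Let $q\in\mathbb{C}\setminus\{0\}$, $n\in\mathbb{Z}_{>0}$, and let $\alpha,\beta,f\in\mathbb{C}[x^{ -1}][[x]]$ with $\alpha,\beta$ nonzero. Suppose $\alpha\,\sigma_qf+f=\beta$ and that $\beta_j\neq0$ for every integer $0<j\le n$, where $\beta_j=\sum_{k=0}^{j-1}(-\alpha\sigma_q)^k\beta$. Then $$L_n^{\alpha,\beta}(f^n)=(-1)^{n(n-1)/2},$$ where $$L_n^{\alpha,\beta}=\frac{1}{\beta_n}\left(\alpha\sigma_q+1\right)\frac{1}{\beta_{n-1}}\left(\alpha^2\sigma_q-1\right)\cdots\frac{1}{\beta_1}\left(\alpha^n\sigma_q-(-1)^n\right),$$ i.e. the composition, from left to right over $i=1,\dots,n$, of the factors $\frac{1}{\beta_{n+1-i}}\left(\alpha^{i}\sigma_q-(-1)^{i}\right)$.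
   Context: $\mathbb{C}[x^{ -1}][[x]]$ is the field of formal Laurent series; $\sigma_qf(x)=f(qx)$; field elements act as multiplication operators and products of operators denote composition. -}

module Defs where

open import Algebra.Apartness.Bundles using (HeytingCommutativeRing; HeytingField)
open import Algebra.Bundles using (CommutativeRing)
open import Algebra.Bundles.Raw using (RawRing)
open import Algebra.Structures using (IsCommutativeRing)
open import Axiom.ExcludedMiddle using (ExcludedMiddle)
open import Data.Empty using (⊥-elim)
open import Data.Fin.Base using (Fin; toℕ)
open import Data.Fin.Properties using (toℕ<n)
open import Data.Integer.Base as ℤ using (ℤ; +_; -[1+_])
import Data.Integer.Properties as ℤₚ
open import Data.Nat.Base as ℕ using (ℕ; zero; suc)
import Data.Nat.Properties as ℕₚ
open import Data.Product.Base using (∃-syntax; _×_; _,_; proj₁; proj₂)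
open import Data.Rational.Base as ℚ using (ℚ; 0ℚ; 1ℚ; ½)
import Data.Rational.Properties as ℚₚ
open import Data.Rational.Solver using (module +-*-Solver)
open import Data.Sum.Base as Sum using (_⊎_; inj₁; inj₂)
open import Data.Vec.Functional using (Vector; foldr; []; _∷_)
open import Function.Base using (_∘_; _∘′_; id)
open import Function.Bundles using (_⇔_; mk⇔)
open import Level using (0ℓ; _⊔_)
open import Relation.Binary.PropositionalEquality
  using (_≡_; _≢_; refl; sym; trans; cong; cong₂; subst; subst₂)
open import Relation.Nullary using (¬_; yes; no)

import Algebra.Apartness.Properties.HeytingCommutativeRing as HeytingProperties
import Algebra.Definitions.RawSemiring as RawSemiringDefs
import Function.Endo.Propositional

module Reals where

  open import Data.Rational.Base using (_+_; _*_; _-_; -_; _≤_; _<_; ∣_∣)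

  Eventually : (ℕ → Set) → Set
  Eventually P = ∃[ N ] ∀ n → N ℕ.≤ n → P n

  Eventually₂ : (ℕ → ℕ → Set) → Set
  Eventually₂ P = ∃[ N ] ∀ m n → N ℕ.≤ m → N ℕ.≤ n → P m n

  Cauchy : (ℕ → ℚ) → Set
  Cauchy s = ∀ ε → 0ℚ < ε → Eventually₂ λ m n → ∣ s m - s n ∣ < ε

  record ℝ : Set where
    constructor mkℝ
    field
      seq    : ℕ → ℚ
      cauchy : Cauchy seq

  open ℝ public

  infix 4 _≈ℝ_ _#ℝ_

  record _≈ℝ_ (x y : ℝ) : Set where
    constructor mk≈
    field
      close : ∀ ε → 0ℚ < ε → Eventually λ n → ∣ seq x n - seq y n ∣ < ε

  open _≈ℝ_ public

  record _#ℝ_ (x y : ℝ) : Set where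
    constructor mk#
    field
      gap   : ℚ
      gap>0 : 0ℚ < gap
      far   : Eventually λ n → gap ≤ ∣ seq x n - seq y n ∣

  private
   opaque

    Ev-zip : {P Q R : ℕ → Set} → (∀ n → P n → Q n → R n) →
             Eventually P → Eventually Q → Eventually R
    Ev-zip f (M , p) (N , q) = M ℕ.⊔ N , λ n le →
      f n (p n (ℕₚ.m⊔n≤o⇒m≤o M N le)) (q n (ℕₚ.m⊔n≤o⇒n≤o M N le))

    Ev-map : {P Q : ℕ → Set} → (∀ n → P n → Q n) → Eventually P → Eventually Q
    Ev-map f (N , p) = N , λ n le → f n (p n le)

    Ev-const : {A : Set} → Eventually (λ _ → A) → A
    Ev-const (N , a) = a N ℕₚ.≤-refl

    Ev₂-zip : {P Q R : ℕ → ℕ → Set} → (∀ m n → P m n → Q m n → R m n) →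
              Eventually₂ P → Eventually₂ Q → Eventually₂ R
    Ev₂-zip f (M , p) (N , q) = M ℕ.⊔ N , λ m n le le′ →
      f m n (p m n (ℕₚ.m⊔n≤o⇒m≤o M N le) (ℕₚ.m⊔n≤o⇒m≤o M N le′))
            (q m n (ℕₚ.m⊔n≤o⇒n≤o M N le) (ℕₚ.m⊔n≤o⇒n≤o M N le′))

    Ev₂-map : {P Q : ℕ → ℕ → Set} → (∀ m n → P m n → Q m n) → Eventually₂ P → Eventually₂ Q
    Ev₂-map f (N , p) = N , λ m n le le′ → f m n (p m n le le′)

    Ev⇒Ev₂ : {P : ℕ → Set} → Eventually P → Eventually₂ (λ m n → P m × P n)
    Ev⇒Ev₂ (N , p) = N , λ m n le le′ → p m le , p n le′

    0<½* : ∀ {ε} → 0ℚ < ε → 0ℚ < ½ * ε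
    0<½* {ε} 0<ε = subst (_< ½ * ε) (ℚₚ.*-zeroʳ ½) (ℚₚ.*-monoʳ-<-pos ½ 0<ε)

    ½+½ : ∀ ε → ½ * ε + ½ * ε ≡ ε
    ½+½ = solve 1 (λ e → con ½ :* e :+ con ½ :* e := e) refl
      where open +-*-Solver

    ∣-∣-sym : ∀ a b → ∣ a - b ∣ ≡ ∣ b - a ∣
    ∣-∣-sym a b = trans (cong ∣_∣ (solve 2 (λ x y → x :- y := :- (y :- x)) refl a b))
                        (ℚₚ.∣-p∣≡∣p∣ (b - a))
      where open +-*-Solver

    ∣-∣-triangle : ∀ a b c → ∣ a - c ∣ ≤ ∣ a - b ∣ + ∣ b - c ∣
    ∣-∣-triangle a b c =
      subst (λ t → ∣ t ∣ ≤ ∣ a - b ∣ + ∣ b - c ∣)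
        (solve 3 (λ x y z → (x :- y) :+ (y :- z) := x :- z) refl a b c)
        (ℚₚ.∣p+q∣≤∣p∣+∣q∣ (a - b) (b - c))
      where open +-*-Solver

    close-trans : ∀ a b c {ε δ} → ∣ a - b ∣ < ε → ∣ b - c ∣ < δ → ∣ a - c ∣ < ε + δ
    close-trans a b c p q = ℚₚ.≤-<-trans (∣-∣-triangle a b c) (ℚₚ.+-mono-< p q)

    close-+ : ∀ a b c d {ε δ} → ∣ a - c ∣ < ε → ∣ b - d ∣ < δ → ∣ (a + b) - (c + d) ∣ < ε + δ
    close-+ a b c d {ε} {δ} p q = subst (λ t → ∣ t ∣ < ε + δ)
      (solve 4 (λ a b c d → (a :- c) :+ (b :- d) := (a :+ b) :- (c :+ d)) refl a b c d)
      (ℚₚ.≤-<-trans (ℚₚ.∣p+q∣≤∣p∣+∣q∣ (a - c) (b - d)) (ℚₚ.+-mono-< p q))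
      where open +-*-Solver

    ∣-∣-neg : ∀ a b → ∣ (- a) - (- b) ∣ ≡ ∣ a - b ∣
    ∣-∣-neg a b = trans (cong ∣_∣ (solve 2 (λ x y → :- x :- :- y := y :- x) refl a b)) (∣-∣-sym b a)
      where open +-*-Solver

    ∣x-x∣≡0 : ∀ a → ∣ a - a ∣ ≡ 0ℚ
    ∣x-x∣≡0 a = cong ∣_∣ (ℚₚ.+-inverseʳ a)

    -≡+- : ∀ a b → a - b ≡ a + (- b)
    -≡+- _ _ = refl

    x-0≡x : ∀ a → a - 0ℚ ≡ a
    x-0≡x = ℚₚ.+-identityʳ

    recip : ℚ → ℚ
    recip p with p ℚₚ.≟ 0ℚ
    ... | yes _   = 0ℚ
    ... | no  p≢0 = ℚ.1/_ p {{ℚ.≢-nonZero p≢0}}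

    recip-inverseʳ : ∀ p → p ≢ 0ℚ → p * recip p ≡ 1ℚ
    recip-inverseʳ p p≢0 with p ℚₚ.≟ 0ℚ
    ... | yes p≡0 = ⊥-elim (p≢0 p≡0)
    ... | no  p≢0′ = ℚₚ.*-inverseʳ p {{ℚ.≢-nonZero p≢0′}}

    divide : ∀ {A η} → 0ℚ < A → 0ℚ < η → ∃[ δ ] 0ℚ < δ × A * δ ≡ η
    divide {A} {η} 0<A 0<η = divide′ A η (ℚ.positive 0<A) (ℚ.positive 0<η)
      where
      divide′ : ∀ A η → ℚ.Positive A → ℚ.Positive η → ∃[ δ ] 0ℚ < δ × A * δ ≡ η
      divide′ A η A⁺ η⁺ = A⁻¹ * η , ℚₚ.positive⁻¹ _ {{A⁻¹η⁺}} ,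
        trans (sym (ℚₚ.*-assoc A A⁻¹ η))
          (trans (cong (_* η) (ℚₚ.*-inverseʳ A {{A≠0}})) (ℚₚ.*-identityˡ η))
        where
        A≠0 : ℚ.NonZero A
        A≠0 = ℚₚ.pos⇒nonZero A {{A⁺}}
        A⁻¹ : ℚ
        A⁻¹ = ℚ.1/_ A {{A≠0}}
        A⁻¹η⁺ : ℚ.Positive (A⁻¹ * η)
        A⁻¹η⁺ = ℚₚ.pos*pos⇒pos A⁻¹ {{ℚₚ.1/pos⇒pos A {{A⁺}}}} η {{η⁺}}

    ∣*∣-bound : ∀ a x {A δ} → 0ℚ < A → ∣ a ∣ ≤ A → ∣ x ∣ < δ → ∣ a * x ∣ < A * δ
    ∣*∣-bound a x {A} {δ} 0<A a≤A x<δ = subst (_< A * δ) (sym (ℚₚ.∣p*q∣≡∣p∣*∣q∣ a x))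
      (ℚₚ.≤-<-trans (ℚₚ.*-monoʳ-≤-nonNeg ∣ x ∣ {{ℚₚ.∣-∣-nonNeg x}} a≤A)
                    (ℚₚ.*-monoʳ-<-pos A {{ℚ.positive 0<A}} x<δ))

    close-* : ∀ {A D δ} → 0ℚ < A → 0ℚ < D → ∀ a b c d → ∣ a ∣ ≤ A → ∣ d ∣ ≤ D →
              ∣ a - c ∣ < δ → ∣ b - d ∣ < δ → ∣ a * b - c * d ∣ < (A + D) * δ
    close-* {A} {D} {δ} 0<A 0<D a b c d a≤A d≤D a~c b~d = subst₂ (λ t u → ∣ t ∣ < u)
      (solve 4 (λ a b c d → a :* (b :- d) :+ d :* (a :- c) := a :* b :- c :* d) refl a b c d)
      (sym (ℚₚ.*-distribʳ-+ δ A D))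
      (ℚₚ.≤-<-trans (ℚₚ.∣p+q∣≤∣p∣+∣q∣ (a * (b - d)) (d * (a - c)))
        (ℚₚ.+-mono-< (∣*∣-bound a (b - d) 0<A a≤A b~d) (∣*∣-bound d (a - c) 0<D d≤D a~c)))
      where open +-*-Solver

    0<1 : 0ℚ < 1ℚ
    0<1 = ℚₚ.positive⁻¹ 1ℚ

    0<½ : 0ℚ < ½
    0<½ = ℚₚ.positive⁻¹ ½

    bounded : ∀ x → ∃[ B ] 0ℚ < B × Eventually λ n → ∣ seq x n ∣ ≤ B
    bounded x = prf 1ℚ 0<1 (cauchy x 1ℚ 0<1)
      where
      prf : ∀ ε → 0ℚ < ε → Eventually₂ (λ m n → ∣ seq x m - seq x n ∣ < ε) →
            ∃[ B ] 0ℚ < B × Eventually λ n → ∣ seq x n ∣ ≤ B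
      prf ε 0<ε (N , p) = ε + ∣ seq x N ∣ , ℚₚ.+-mono-<-≤ 0<ε (ℚₚ.0≤∣p∣ (seq x N)) , N , λ n le →
        ℚₚ.≤-trans
          (subst₂ (λ t u → ∣ t ∣ ≤ ∣ seq x n - seq x N ∣ + ∣ u ∣)
            (x-0≡x (seq x n)) (x-0≡x (seq x N)) (∣-∣-triangle (seq x n) (seq x N) 0ℚ))
          (ℚₚ.+-monoˡ-≤ ∣ seq x N ∣ (ℚₚ.<⇒≤ (p n N le ℕₚ.≤-refl)))

  private
   opaque

    const-cauchy : ∀ p → Cauchy (λ _ → p)
    const-cauchy p ε 0<ε = 0 , λ _ _ _ _ → subst (_< ε) (sym (∣x-x∣≡0 p)) 0<ε

    +-cauchy : ∀ x y → Cauchy (λ n → seq x n + seq y n)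
    +-cauchy x y ε 0<ε = Ev₂-zip
      (λ m n p q → subst (∣ (seq x m + seq y m) - (seq x n + seq y n) ∣ <_) (½+½ ε)
                     (close-+ (seq x m) (seq y m) (seq x n) (seq y n) p q))
      (cauchy x (½ * ε) (0<½* 0<ε)) (cauchy y (½ * ε) (0<½* 0<ε))

    neg-cauchy : ∀ x → Cauchy (λ n → - seq x n)
    neg-cauchy x ε 0<ε = Ev₂-map
      (λ m n → subst (_< ε) (sym (∣-∣-neg (seq x m) (seq x n)))) (cauchy x ε 0<ε)

    diff-cauchy : ∀ x y → Cauchy (λ n → seq x n - seq y n)
    diff-cauchy x y ε 0<ε = Ev₂-zip
      (λ m n p q → subst₂ (λ t u → ∣ t - u ∣ < ε)
        (sym (-≡+- (seq x m) (seq y m))) (sym (-≡+- (seq x n) (seq y n)))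
        (subst (∣ (seq x m + (- seq y m)) - (seq x n + (- seq y n)) ∣ <_) (½+½ ε)
          (close-+ (seq x m) (- seq y m) (seq x n) (- seq y n) p q)))
      (cauchy x (½ * ε) (0<½* 0<ε)) (neg-cauchy y (½ * ε) (0<½* 0<ε))

    *-cauchy : ∀ x y → Cauchy (λ n → seq x n * seq y n)
    *-cauchy x y ε 0<ε with bounded x | bounded y
    ... | A , 0<A , x≤A | D , 0<D , y≤D with divide (ℚₚ.+-mono-< 0<A 0<D) 0<ε
    ... | δ , 0<δ , eq = Ev₂-zip
      (λ { m n (p , _) ((_ , q) , r , s) → subst (∣ seq x m * seq y m - seq x n * seq y n ∣ <_) eq
             (close-* 0<A 0<D (seq x m) (seq y m) (seq x n) (seq y n) p q r s) })
      (Ev⇒Ev₂ x≤A)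
      (Ev₂-zip (λ _ _ → _,_) (Ev⇒Ev₂ y≤D) (Ev₂-zip (λ _ _ → _,_) (cauchy x δ 0<δ) (cauchy y δ 0<δ)))

  infixl 6 _+ℝ_ _-ℝ_
  infixl 7 _*ℝ_
  infix  8 -ℝ_

  constℝ : ℚ → ℝ
  constℝ p = mkℝ (λ _ → p) (const-cauchy p)

  _+ℝ_ : ℝ → ℝ → ℝ
  x +ℝ y = mkℝ (λ n → seq x n + seq y n) (+-cauchy x y)

  -ℝ_ : ℝ → ℝ
  -ℝ x = mkℝ (λ n → - seq x n) (neg-cauchy x)

  _-ℝ_ : ℝ → ℝ → ℝ
  x -ℝ y = x +ℝ (-ℝ y)

  _*ℝ_ : ℝ → ℝ → ℝ
  x *ℝ y = mkℝ (λ n → seq x n * seq y n) (*-cauchy x y)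

  pointwise : ∀ {x y} → (∀ n → seq x n ≡ seq y n) → x ≈ℝ y
  pointwise {x} {y} eq = mk≈ λ ε 0<ε → 0 , λ n _ →
    subst (_< ε) (sym (trans (cong (λ t → ∣ t - seq y n ∣) (eq n)) (∣x-x∣≡0 (seq y n)))) 0<ε

  private
   opaque

    ≈ℝ-sym : ∀ {x y} → x ≈ℝ y → y ≈ℝ x
    ≈ℝ-sym {x} {y} p = mk≈ λ ε 0<ε →
      Ev-map (λ n → subst (_< ε) (∣-∣-sym (seq x n) (seq y n))) (close p ε 0<ε)

    ≈ℝ-trans : ∀ {x y z} → x ≈ℝ y → y ≈ℝ z → x ≈ℝ z
    ≈ℝ-trans {x} {y} {z} p q = mk≈ λ ε 0<ε → Ev-zip
      (λ n r s → subst (∣ seq x n - seq z n ∣ <_) (½+½ ε)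
                   (close-trans (seq x n) (seq y n) (seq z n) r s))
      (close p (½ * ε) (0<½* 0<ε)) (close q (½ * ε) (0<½* 0<ε))

    +ℝ-cong : ∀ {x x′ y y′} → x ≈ℝ x′ → y ≈ℝ y′ → x +ℝ y ≈ℝ x′ +ℝ y′
    +ℝ-cong {x} {x′} {y} {y′} p q = mk≈ λ ε 0<ε → Ev-zip
      (λ n r s → subst (∣ (seq x n + seq y n) - (seq x′ n + seq y′ n) ∣ <_) (½+½ ε)
                   (close-+ (seq x n) (seq y n) (seq x′ n) (seq y′ n) r s))
      (close p (½ * ε) (0<½* 0<ε)) (close q (½ * ε) (0<½* 0<ε))

    -ℝ-cong : ∀ {x x′} → x ≈ℝ x′ → -ℝ x ≈ℝ -ℝ x′
    -ℝ-cong {x} {x′} p = mk≈ λ ε 0<ε →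
      Ev-map (λ n → subst (_< ε) (sym (∣-∣-neg (seq x n) (seq x′ n)))) (close p ε 0<ε)

    *ℝ-cong : ∀ {x x′ y y′} → x ≈ℝ x′ → y ≈ℝ y′ → x *ℝ y ≈ℝ x′ *ℝ y′
    *ℝ-cong {x} {x′} {y} {y′} p q = mk≈ prf
      where
      prf : ∀ ε → 0ℚ < ε → Eventually λ n → ∣ seq x n * seq y n - seq x′ n * seq y′ n ∣ < ε
      prf ε 0<ε with bounded x | bounded y′
      ... | A , 0<A , x≤A | D , 0<D , y′≤D with divide (ℚₚ.+-mono-< 0<A 0<D) 0<ε
      ... | δ , 0<δ , eq = Ev-zip
        (λ { n (a , d) (r , s) → subst (∣ seq x n * seq y n - seq x′ n * seq y′ n ∣ <_) eq
               (close-* 0<A 0<D (seq x n) (seq y n) (seq x′ n) (seq y′ n) a d r s) })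
        (Ev-zip (λ _ → _,_) x≤A y′≤D) (Ev-zip (λ _ → _,_) (close p δ 0<δ) (close q δ 0<δ))

    ε≤0⇒⊥ : ∀ {ε} → 0ℚ < ε → ε ≤ 0ℚ → ∀ {A : Set} → A
    ε≤0⇒⊥ 0<ε ε≤0 = ⊥-elim (ℚₚ.<-irrefl refl (ℚₚ.<-≤-trans 0<ε ε≤0))

    #ℝ⇒≉ : ∀ {x y} → x ≈ℝ y → ¬ (x #ℝ y)
    #ℝ⇒≉ p (mk# ε 0<ε q) = Ev-const
      (Ev-zip (λ n r s → ℚₚ.<-irrefl refl (ℚₚ.<-≤-trans r s)) (close p ε 0<ε) q)

    #ℝ-sym : ∀ {x y} → x #ℝ y → y #ℝ x
    #ℝ-sym {x} {y} (mk# ε 0<ε p) =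
      mk# ε 0<ε (Ev-map (λ n → subst (ε ≤_) (∣-∣-sym (seq x n) (seq y n))) p)

    away : ∀ (w : ℕ → ℚ) {η} → 0ℚ < η → ∀ N → (∀ m n → N ℕ.≤ m → N ℕ.≤ n → ∣ w m - w n ∣ < η) →
           ∀ k → N ℕ.≤ k → η + η ≤ ∣ w k ∣ → ∀ n → N ℕ.≤ n → η ≤ ∣ w n ∣
    away w {η} 0<η N c k N≤k big n N≤n = ℚₚ.≮⇒≥ λ small → ℚₚ.<-irrefl refl
      (ℚₚ.<-≤-trans
        (subst (λ t → ∣ t ∣ < η + η) (x-0≡x (w k))
          (close-trans (w k) (w n) 0ℚ (c k n N≤k N≤n)
            (subst (λ t → ∣ t ∣ < η) (sym (x-0≡x (w n))) small)))
        big)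

    #ℝ-cotrans : ∀ {x y} → x #ℝ y → ∀ z → (x #ℝ z) ⊎ (z #ℝ y)
    #ℝ-cotrans {x} {y} (mk# ε 0<ε (N , p)) z =
      split (diff-cauchy x z η 0<η) (diff-cauchy z y η 0<η)
      where
      η : ℚ
      η = ½ * (½ * ε)
      0<η : 0ℚ < η
      0<η = 0<½* (0<½* 0<ε)
      split : Eventually₂ (λ m n → ∣ (seq x m - seq z m) - (seq x n - seq z n) ∣ < η) →
              Eventually₂ (λ m n → ∣ (seq z m - seq y m) - (seq z n - seq y n) ∣ < η) →
              (x #ℝ z) ⊎ (z #ℝ y)
      split (N₁ , c₁) (N₂ , c₂) = decide (ℚₚ.≤-total (½ * ε) (∣ seq x k - seq z k ∣))
        where
        k : ℕ
        k = N ℕ.⊔ (N₁ ℕ.⊔ N₂)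
        N≤k : N ℕ.≤ k
        N≤k = ℕₚ.m≤m⊔n N (N₁ ℕ.⊔ N₂)
        N₁≤k : N₁ ℕ.≤ k
        N₁≤k = ℕₚ.≤-trans (ℕₚ.m≤m⊔n N₁ N₂) (ℕₚ.m≤n⊔m N (N₁ ℕ.⊔ N₂))
        N₂≤k : N₂ ℕ.≤ k
        N₂≤k = ℕₚ.≤-trans (ℕₚ.m≤n⊔m N₁ N₂) (ℕₚ.m≤n⊔m N (N₁ ℕ.⊔ N₂))
        far₂ : ∣ seq x k - seq z k ∣ ≤ ½ * ε → ½ * ε ≤ ∣ seq z k - seq y k ∣
        far₂ near = ℚₚ.≮⇒≥ λ near′ → ℚₚ.<-irrefl refl (ℚₚ.<-≤-trans
          (subst (∣ seq x k - seq y k ∣ <_) (½+½ ε)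
            (ℚₚ.≤-<-trans (∣-∣-triangle (seq x k) (seq z k) (seq y k))
                          (ℚₚ.+-mono-≤-< near near′)))
          (p k N≤k))
        decide : ½ * ε ≤ ∣ seq x k - seq z k ∣ ⊎ ∣ seq x k - seq z k ∣ ≤ ½ * ε →
                 (x #ℝ z) ⊎ (z #ℝ y)
        decide (inj₁ far) = inj₁ (mk# η 0<η (N₁ ,
          away (λ i → seq x i - seq z i) 0<η N₁ c₁ k N₁≤k (ℚₚ.≤-trans (ℚₚ.≤-reflexive (½+½ (½ * ε))) far)))
        decide (inj₂ near) = inj₂ (mk# η 0<η (N₂ ,
          away (λ i → seq z i - seq y i) 0<η N₂ c₂ k N₂≤k (ℚₚ.≤-trans (ℚₚ.≤-reflexive (½+½ (½ * ε))) (far₂ near))))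

    #ℝ-tight : ∀ {x y} → ¬ (x #ℝ y) → x ≈ℝ y
    #ℝ-tight {x} {y} ¬x#y = mk≈ λ ε 0<ε → prf ε 0<ε (diff-cauchy x y (½ * ε) (0<½* 0<ε))
      where
      prf : ∀ ε → 0ℚ < ε → Eventually₂ (λ m n → ∣ (seq x m - seq y m) - (seq x n - seq y n) ∣ < ½ * ε) →
            Eventually (λ n → ∣ seq x n - seq y n ∣ < ε)
      prf ε 0<ε (N , c) = N , λ n N≤n → ℚₚ.≰⇒> λ far → ¬x#y (mk# (½ * ε) (0<½* 0<ε) (N ,
        away (λ i → seq x i - seq y i) (0<½* 0<ε) N c n N≤n (ℚₚ.≤-trans (ℚₚ.≤-reflexive (½+½ ε)) far)))

    *ℝ-comm : ∀ x y → x *ℝ y ≈ℝ y *ℝ x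
    *ℝ-comm x y = pointwise λ n → ℚₚ.*-comm (seq x n) (seq y n)

  opaque

    #ℝ⇒inverse : ∀ {x y} → x #ℝ y → ∃[ r ] r *ℝ (x -ℝ y) ≈ℝ constℝ 1ℚ
    #ℝ⇒inverse {x} {y} (mk# ε 0<ε (N , far)) with divide 0<ε 0<1
    ... | E , 0<E , εE≡1 = mkℝ r r-cauchy , r-inverse
      where
      z : ℕ → ℚ
      z = seq (x -ℝ y)
      r : ℕ → ℚ
      r n = recip (z n)
      inv : ∀ n → N ℕ.≤ n → z n * r n ≡ 1ℚ
      inv n le = recip-inverseʳ (z n) λ z≡0 →
        ε≤0⇒⊥ 0<ε (subst (λ t → ε ≤ ∣ t ∣) z≡0 (far n le))
      r≤E : ∀ n → N ℕ.≤ n → ∣ r n ∣ ≤ E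
      r≤E n le = ℚₚ.*-cancelˡ-≤-pos ε {{ℚ.positive 0<ε}}
        (subst (ε * ∣ r n ∣ ≤_)
          (trans (sym (ℚₚ.∣p*q∣≡∣p∣*∣q∣ (z n) (r n))) (trans (cong ∣_∣ (inv n le)) (sym εE≡1)))
          (ℚₚ.*-monoʳ-≤-nonNeg ∣ r n ∣ {{ℚₚ.∣-∣-nonNeg (r n)}} (far n le)))
      r-diff : ∀ m n → N ℕ.≤ m → N ℕ.≤ n → r m * (r n * (z n - z m)) ≡ r m - r n
      r-diff m n le le′ = trans
        (solve 4 (λ a b u v → a :* (b :* (u :- v)) := a :* (u :* b) :- b :* (v :* a))
          refl (r m) (r n) (z n) (z m))
        (cong₂ _-_ (trans (cong (r m *_) (inv n le′)) (ℚₚ.*-identityʳ (r m)))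
                   (trans (cong (r n *_) (inv m le)) (ℚₚ.*-identityʳ (r n))))
        where open +-*-Solver
      r-cauchy : Cauchy r
      r-cauchy η 0<η with divide 0<E 0<η
      ... | δ , 0<δ , Eδ≡η with divide 0<E 0<δ
      ... | θ , 0<θ , Eθ≡δ = Ev₂-zip
        (λ { m n (le , le′) c → subst₂ (λ t u → ∣ t ∣ < u) (r-diff m n le le′) Eδ≡η
          (∣*∣-bound (r m) (r n * (z n - z m)) 0<E (r≤E m le)
            (subst (∣ r n * (z n - z m) ∣ <_) Eθ≡δ
              (∣*∣-bound (r n) (z n - z m) 0<E (r≤E n le′)
                (subst (_< θ) (∣-∣-sym (z m) (z n)) c)))) })
        (N , λ _ _ → _,_) (cauchy (x -ℝ y) θ 0<θ)
      r-inverse : mkℝ r r-cauchy *ℝ (x -ℝ y) ≈ℝ constℝ 1ℚ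
      r-inverse = mk≈ λ η 0<η → N , λ n le → subst (_< η)
        (sym (trans (cong (λ t → ∣ t - 1ℚ ∣) (trans (ℚₚ.*-comm (r n) (z n)) (inv n le)))
                    (∣x-x∣≡0 1ℚ))) 0<η

    inverse⇒#ℝ : ∀ {x y} → ∃[ r ] r *ℝ (x -ℝ y) ≈ℝ constℝ 1ℚ → x #ℝ y
    inverse⇒#ℝ {x} {y} (r , p) = apart (bounded r)
      where
      z : ℕ → ℚ
      z = seq (x -ℝ y)
      bound : ∀ {B δ} → 0ℚ < B → B * δ ≡ ½ →
              ∀ n → ∣ seq r n ∣ ≤ B → ∣ seq r n * z n - 1ℚ ∣ < ½ → δ ≤ ∣ z n ∣
      bound {B} {δ} 0<B Bδ≡½ n le near = ℚₚ.≮⇒≥ λ small → ℚₚ.<-irrefl {∣ 1ℚ - 0ℚ ∣} {½ + ½} refl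
        (close-trans 1ℚ (seq r n * z n) 0ℚ {½} {½}
          (subst (_< ½) (∣-∣-sym (seq r n * z n) 1ℚ) near)
          (subst₂ (λ t u → ∣ t ∣ < u) (sym (x-0≡x (seq r n * z n))) Bδ≡½
            (∣*∣-bound (seq r n) (z n) {B} {δ} 0<B le small)))
      apart : ∃[ B ] 0ℚ < B × Eventually (λ n → ∣ seq r n ∣ ≤ B) → x #ℝ y
      apart (B , 0<B , r≤B) = away-from-0 (divide 0<B 0<½)
        where
        away-from-0 : ∃[ δ ] 0ℚ < δ × B * δ ≡ ½ → x #ℝ y
        away-from-0 (δ , 0<δ , Bδ≡½) =
          mk# δ 0<δ (Ev-zip (bound 0<B Bδ≡½) r≤B (close p ½ 0<½))

    sumOfSquares-# : ∀ a b → (a #ℝ constℝ 0ℚ) ⊎ (b #ℝ constℝ 0ℚ) → a *ℝ a +ℝ b *ℝ b #ℝ constℝ 0ℚ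
    sumOfSquares-# a b = Sum.[ left a b , (λ p → transport (left b a p)) ]
      where
      0≤sq : ∀ p → 0ℚ ≤ p * p
      0≤sq p = Sum.[ (λ 0≤p → ℚₚ.nonNegative⁻¹ (p * p)
                         {{ℚₚ.nonNeg*nonNeg⇒nonNeg p {{ℚ.nonNegative 0≤p}} p {{ℚ.nonNegative 0≤p}}}})
                   , (λ p≤0 → ℚₚ.nonNegative⁻¹ (p * p)
                         {{ℚₚ.nonPos*nonPos⇒nonPos p {{ℚ.nonPositive p≤0}} p {{ℚ.nonPositive p≤0}}}})
                   ]′ (ℚₚ.≤-total 0ℚ p)
      left : ∀ a b → a #ℝ constℝ 0ℚ → a *ℝ a +ℝ b *ℝ b #ℝ constℝ 0ℚ
      left a b (mk# ε 0<ε p) = mk# (ε * ε) ε²>0 (Ev-map bound p)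
        where
        instance
          ε⁺ : ℚ.Positive ε
          ε⁺ = ℚ.positive 0<ε
        ε²>0 : 0ℚ < ε * ε
        ε²>0 = ℚₚ.positive⁻¹ (ε * ε) {{ℚₚ.pos*pos⇒pos ε ε}}
        bound : ∀ n → ε ≤ ∣ seq a n - 0ℚ ∣ → ε * ε ≤ ∣ (seq a n * seq a n + seq b n * seq b n) - 0ℚ ∣
        bound n far = ℚₚ.≤-trans
          (ℚₚ.≤-trans (ℚₚ.*-monoʳ-≤-nonNeg ε {{ℚₚ.pos⇒nonNeg ε}} far′)
            (ℚₚ.≤-trans (ℚₚ.*-monoˡ-≤-nonNeg ∣ u ∣ {{ℚₚ.∣-∣-nonNeg u}} far′)
              (ℚₚ.≤-reflexive (trans (sym (ℚₚ.∣p*q∣≡∣p∣*∣q∣ u u)) (ℚₚ.0≤p⇒∣p∣≡p (0≤sq u))))))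
          (subst₂ _≤_ (ℚₚ.+-identityʳ (u * u))
            (sym (trans (cong ∣_∣ (x-0≡x (u * u + v * v)))
                        (ℚₚ.0≤p⇒∣p∣≡p (ℚₚ.+-mono-≤ (0≤sq u) (0≤sq v)))))
            (ℚₚ.+-monoʳ-≤ (u * u) (0≤sq v)))
          where
          u : ℚ
          u = seq a n
          v : ℚ
          v = seq b n
          far′ : ε ≤ ∣ u ∣
          far′ = subst (λ t → ε ≤ ∣ t ∣) (x-0≡x u) far
      transport : b *ℝ b +ℝ a *ℝ a #ℝ constℝ 0ℚ → a *ℝ a +ℝ b *ℝ b #ℝ constℝ 0ℚ
      transport (mk# ε 0<ε p) = mk# ε 0<ε (Ev-map
        (λ n → subst (λ t → ε ≤ ∣ t - 0ℚ ∣) (ℚₚ.+-comm (seq b n * seq b n) (seq a n * seq a n))) p)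

  ℝ-isCommutativeRing : IsCommutativeRing _≈ℝ_ _+ℝ_ _*ℝ_ -ℝ_ (constℝ 0ℚ) (constℝ 1ℚ)
  ℝ-isCommutativeRing = record
    { isRing = record
      { +-isAbelianGroup = record
        { isGroup = record
          { isMonoid = record
            { isSemigroup = record
              { isMagma = record
                { isEquivalence = record
                  { refl  = pointwise λ _ → refl
                  ; sym   = ≈ℝ-sym
                  ; trans = ≈ℝ-trans
                  }
                ; ∙-cong = +ℝ-cong
                }
              ; assoc = λ x y z → pointwise λ n → ℚₚ.+-assoc (seq x n) (seq y n) (seq z n)
              }
            ; identity = (λ x → pointwise λ n → ℚₚ.+-identityˡ (seq x n))
                       , (λ x → pointwise λ n → ℚₚ.+-identityʳ (seq x n))
            }
          ; inverse = (λ x → pointwise λ n → ℚₚ.+-inverseˡ (seq x n))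
                    , (λ x → pointwise λ n → ℚₚ.+-inverseʳ (seq x n))
          ; ⁻¹-cong = -ℝ-cong
          }
        ; comm = λ x y → pointwise λ n → ℚₚ.+-comm (seq x n) (seq y n)
        }
      ; *-cong = *ℝ-cong
      ; *-assoc = λ x y z → pointwise λ n → ℚₚ.*-assoc (seq x n) (seq y n) (seq z n)
      ; *-identity = (λ x → pointwise λ n → ℚₚ.*-identityˡ (seq x n))
                   , (λ x → pointwise λ n → ℚₚ.*-identityʳ (seq x n))
      ; distrib = (λ x y z → pointwise λ n → ℚₚ.*-distribˡ-+ (seq x n) (seq y n) (seq z n))
                , (λ x y z → pointwise λ n → ℚₚ.*-distribʳ-+ (seq x n) (seq y n) (seq z n))
      }
    ; *-comm = *ℝ-comm
    }

  ℝ-heytingField : HeytingField 0ℓ 0ℓ 0ℓ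
  ℝ-heytingField = record
    { Carrier = ℝ ; _≈_ = _≈ℝ_ ; _#_ = _#ℝ_ ; _+_ = _+ℝ_ ; _*_ = _*ℝ_ ; -_ = -ℝ_
    ; 0# = constℝ 0ℚ ; 1# = constℝ 1ℚ
    ; isHeytingField = record
      { isHeytingCommutativeRing = record
        { isCommutativeRing = ℝ-isCommutativeRing
        ; isApartnessRelation = record
          { irrefl  = #ℝ⇒≉
          ; sym     = #ℝ-sym
          ; cotrans = #ℝ-cotrans
          }
        ; #⇒invertible = λ {x} {y} x#y → let r , p = #ℝ⇒inverse x#y in
            r , p , ≈ℝ-trans (*ℝ-comm (x -ℝ y) r) p
        ; invertible⇒# = λ (r , p , _) → inverse⇒#ℝ (r , p)
        }
      ; tight = λ x y → #ℝ-tight , #ℝ⇒≉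
      }
    }

module Complexes where

  open Reals

  record ℂ : Set where
    constructor _+i_
    field
      re im : ℝ

  open ℂ public

  infix 5 _+i_
  infix 4 _≈ℂ_
  infixl 6 _+ℂ_ _-ℂ_
  infixl 7 _*ℂ_
  infix  8 -ℂ_

  record _≈ℂ_ (z w : ℂ) : Set where
    constructor mk≈
    field
      re≈ : re z ≈ℝ re w
      im≈ : im z ≈ℝ im w

  _#ℂ_ : ℂ → ℂ → Set
  z #ℂ w = (re z #ℝ re w) ⊎ (im z #ℝ im w)

  0ℂ 1ℂ : ℂ
  0ℂ = constℝ 0ℚ +i constℝ 0ℚ
  1ℂ = constℝ 1ℚ +i constℝ 0ℚ

  _+ℂ_ _*ℂ_ : ℂ → ℂ → ℂ
  (a +i b) +ℂ (c +i d) = (a +ℝ c) +i (b +ℝ d)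
  (a +i b) *ℂ (c +i d) = (a *ℝ c -ℝ b *ℝ d) +i (a *ℝ d +ℝ b *ℝ c)

  -ℂ_ : ℂ → ℂ
  -ℂ (a +i b) = (-ℝ a) +i (-ℝ b)

  _-ℂ_ : ℂ → ℂ → ℂ
  z -ℂ w = z +ℂ (-ℂ w)

  private
   module R = HeytingField ℝ-heytingField
   module Rₚ = HeytingProperties R.heytingCommutativeRing

   opaque

    *ℂ-assoc : ∀ x y z → (x *ℂ y) *ℂ z ≈ℂ x *ℂ (y *ℂ z)
    *ℂ-assoc (a +i b) (c +i d) (e +i f) = mk≈
      (pointwise λ n → solve 6 (λ a b c d e f →
        (a :* c :+ :- (b :* d)) :* e :+ :- ((a :* d :+ b :* c) :* f) :=
        a :* (c :* e :+ :- (d :* f)) :+ :- (b :* (c :* f :+ d :* e)))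
        refl (seq a n) (seq b n) (seq c n) (seq d n) (seq e n) (seq f n))
      (pointwise λ n → solve 6 (λ a b c d e f →
        (a :* c :+ :- (b :* d)) :* f :+ (a :* d :+ b :* c) :* e :=
        a :* (c :* f :+ d :* e) :+ b :* (c :* e :+ :- (d :* f)))
        refl (seq a n) (seq b n) (seq c n) (seq d n) (seq e n) (seq f n))
      where open +-*-Solver

    *ℂ-comm : ∀ x y → x *ℂ y ≈ℂ y *ℂ x
    *ℂ-comm (a +i b) (c +i d) = mk≈
      (pointwise λ n → solve 4 (λ a b c d → a :* c :+ :- (b :* d) := c :* a :+ :- (d :* b))
        refl (seq a n) (seq b n) (seq c n) (seq d n))
      (pointwise λ n → solve 4 (λ a b c d → a :* d :+ b :* c := c :* b :+ d :* a)
        refl (seq a n) (seq b n) (seq c n) (seq d n))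
      where open +-*-Solver

    *ℂ-identityˡ : ∀ x → 1ℂ *ℂ x ≈ℂ x
    *ℂ-identityˡ (a +i b) = mk≈
      (pointwise λ n → solve 2 (λ a b → con 1ℚ :* a :+ :- (con 0ℚ :* b) := a)
        refl (seq a n) (seq b n))
      (pointwise λ n → solve 2 (λ a b → con 1ℚ :* b :+ con 0ℚ :* a := b)
        refl (seq a n) (seq b n))
      where open +-*-Solver

    *ℂ-distribˡ-+ : ∀ x y z → x *ℂ (y +ℂ z) ≈ℂ x *ℂ y +ℂ x *ℂ z
    *ℂ-distribˡ-+ (a +i b) (c +i d) (e +i f) = mk≈
      (pointwise λ n → solve 6 (λ a b c d e f →
        a :* (c :+ e) :+ :- (b :* (d :+ f)) :=
        (a :* c :+ :- (b :* d)) :+ (a :* e :+ :- (b :* f)))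
        refl (seq a n) (seq b n) (seq c n) (seq d n) (seq e n) (seq f n))
      (pointwise λ n → solve 6 (λ a b c d e f →
        a :* (d :+ f) :+ b :* (c :+ e) :=
        (a :* d :+ b :* c) :+ (a :* f :+ b :* e))
        refl (seq a n) (seq b n) (seq c n) (seq d n) (seq e n) (seq f n))
      where open +-*-Solver

    +ℂ-cong : ∀ {x x′ y y′} → x ≈ℂ x′ → y ≈ℂ y′ → x +ℂ y ≈ℂ x′ +ℂ y′
    +ℂ-cong (mk≈ p q) (mk≈ r s) = mk≈ (R.+-cong p r) (R.+-cong q s)

    -ℂ-cong : ∀ {x x′} → x ≈ℂ x′ → -ℂ x ≈ℂ -ℂ x′
    -ℂ-cong (mk≈ p q) = mk≈ (R.-‿cong p) (R.-‿cong q)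

    *ℂ-cong : ∀ {x x′ y y′} → x ≈ℂ x′ → y ≈ℂ y′ → x *ℂ y ≈ℂ x′ *ℂ y′
    *ℂ-cong (mk≈ p q) (mk≈ r s) = mk≈
      (R.+-cong (R.*-cong p r) (R.-‿cong (R.*-cong q s)))
      (R.+-cong (R.*-cong p s) (R.*-cong q r))

    ≈ℂ-refl : ∀ {x} → x ≈ℂ x
    ≈ℂ-refl = mk≈ R.refl R.refl

    ≈ℂ-sym : ∀ {x y} → x ≈ℂ y → y ≈ℂ x
    ≈ℂ-sym (mk≈ p q) = mk≈ (R.sym p) (R.sym q)

    ≈ℂ-trans : ∀ {x y z} → x ≈ℂ y → y ≈ℂ z → x ≈ℂ z
    ≈ℂ-trans (mk≈ p q) (mk≈ r s) = mk≈ (R.trans p r) (R.trans q s)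

    #ℂ-cotrans : ∀ {x y} → x #ℂ y → ∀ z → (x #ℂ z) ⊎ (z #ℂ y)
    #ℂ-cotrans (inj₁ p) z = Sum.map inj₁ inj₁ (R.#-cotrans p (re z))
    #ℂ-cotrans (inj₂ p) z = Sum.map inj₂ inj₂ (R.#-cotrans p (im z))

    #ℂ⇒≉ : ∀ {x y} → x ≈ℂ y → ¬ (x #ℂ y)
    #ℂ⇒≉ (mk≈ p q) = Sum.[ R.#-irrefl p , R.#-irrefl q ]

    #ℂ-tight : ∀ {x y} → ¬ (x #ℂ y) → x ≈ℂ y
    #ℂ-tight {x} {y} ¬p = mk≈ (proj₁ (R.tight (re x) (re y)) (¬p ∘ inj₁))
                              (proj₁ (R.tight (im x) (im y)) (¬p ∘ inj₂))

    difference-# : ∀ {x y} → x #ℝ y → (x -ℝ y) #ℝ constℝ 0ℚ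
    difference-# {x} {y} x#y = inverse⇒#ℝ (r , R.trans (pointwise λ n →
        solve 3 (λ r x y → r :* ((x :+ :- y) :+ :- con 0ℚ) := r :* (x :+ :- y))
          refl (seq r n) (seq x n) (seq y n)) p)
      where
      open +-*-Solver
      r : ℝ
      r = proj₁ (#ℝ⇒inverse x#y)
      p : r *ℝ (x -ℝ y) ≈ℝ constℝ 1ℚ
      p = proj₂ (#ℝ⇒inverse x#y)

    -- 1 / (c + i d) = (c - i d) / (c² + d²)
    #ℂ⇒inverse : ∀ {x y} → x #ℂ y → ∃[ w ] w *ℂ (x -ℂ y) ≈ℂ 1ℂ
    #ℂ⇒inverse {x} {y} x#y = (c *ℝ t) +i (-ℝ (d *ℝ t)) , mk≈
      (R.trans (pointwise λ n →
        solve 3 (λ c d t → (c :* t) :* c :+ :- ((:- (d :* t)) :* d) :=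
                           t :* ((c :* c :+ d :* d) :+ :- con 0ℚ))
          refl (seq c n) (seq d n) (seq t n)) p)
      (pointwise λ n →
        solve 3 (λ c d t → (c :* t) :* d :+ (:- (d :* t)) :* c := con 0ℚ)
          refl (seq c n) (seq d n) (seq t n))
      where
      open +-*-Solver
      c d : ℝ
      c = re x -ℝ re y
      d = im x -ℝ im y
      s#0 : (c *ℝ c +ℝ d *ℝ d) #ℝ constℝ 0ℚ
      s#0 = sumOfSquares-# c d (Sum.map difference-# difference-# x#y)
      t : ℝ
      t = proj₁ (#ℝ⇒inverse s#0)
      p : t *ℝ ((c *ℝ c +ℝ d *ℝ d) -ℝ constℝ 0ℚ) ≈ℝ constℝ 1ℚ
      p = proj₂ (#ℝ⇒inverse s#0)

    inverse⇒#ℂ : ∀ {x y} → ∃[ w ] w *ℂ (x -ℂ y) ≈ℂ 1ℂ → x #ℂ y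
    inverse⇒#ℂ {x} {y} (u +i v , mk≈ p _) =
      Sum.map (inverse⇒#ℝ ∘ re-inverse ∘ #ℝ⇒inverse) (inverse⇒#ℝ ∘ im-inverse ∘ #ℝ⇒inverse)
        (R.#-cotrans (Rₚ.#-congʳ (R.sym p) Rₚ.1#0) (-ℝ (v *ℝ d)))
      where
      open +-*-Solver
      c d : ℝ
      c = re x -ℝ re y
      d = im x -ℝ im y
      re-inverse : ∃[ r ] r *ℝ ((u *ℝ c -ℝ v *ℝ d) -ℝ (-ℝ (v *ℝ d))) ≈ℝ constℝ 1ℚ →
                   ∃[ r ] r *ℝ c ≈ℝ constℝ 1ℚ
      re-inverse (r , q) = r *ℝ u , R.trans (pointwise λ n →
        solve 5 (λ r u v c d → (r :* u) :* c := r :* ((u :* c :+ :- (v :* d)) :+ :- (:- (v :* d))))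
          refl (seq r n) (seq u n) (seq v n) (seq c n) (seq d n)) q
      im-inverse : ∃[ r ] r *ℝ ((-ℝ (v *ℝ d)) -ℝ constℝ 0ℚ) ≈ℝ constℝ 1ℚ →
                   ∃[ r ] r *ℝ d ≈ℝ constℝ 1ℚ
      im-inverse (r , q) = r *ℝ (-ℝ v) , R.trans (pointwise λ n →
        solve 3 (λ r v d → (r :* (:- v)) :* d := r :* ((:- (v :* d)) :+ :- con 0ℚ))
          refl (seq r n) (seq v n) (seq d n)) q

  ℂ-isCommutativeRing : IsCommutativeRing _≈ℂ_ _+ℂ_ _*ℂ_ -ℂ_ 0ℂ 1ℂ
  ℂ-isCommutativeRing = record
    { isRing = record
      { +-isAbelianGroup = record
        { isGroup = record
          { isMonoid = record
            { isSemigroup = record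
              { isMagma = record
                { isEquivalence = record { refl = ≈ℂ-refl ; sym = ≈ℂ-sym ; trans = ≈ℂ-trans }
                ; ∙-cong = +ℂ-cong
                }
              ; assoc = λ x y z → mk≈ (R.+-assoc _ _ _) (R.+-assoc _ _ _)
              }
            ; identity = (λ x → mk≈ (R.+-identityˡ _) (R.+-identityˡ _))
                       , (λ x → mk≈ (R.+-identityʳ _) (R.+-identityʳ _))
            }
          ; inverse = (λ x → mk≈ (R.-‿inverseˡ _) (R.-‿inverseˡ _))
                    , (λ x → mk≈ (R.-‿inverseʳ _) (R.-‿inverseʳ _))
          ; ⁻¹-cong = -ℂ-cong
          }
        ; comm = λ x y → mk≈ (R.+-comm _ _) (R.+-comm _ _)
        }
      ; *-cong = *ℂ-cong
      ; *-assoc = *ℂ-assoc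
      ; *-identity = *ℂ-identityˡ , λ x → ≈ℂ-trans (*ℂ-comm x 1ℂ) (*ℂ-identityˡ x)
      ; distrib = *ℂ-distribˡ-+ , λ x y z → ≈ℂ-trans (*ℂ-comm (y +ℂ z) x)
          (≈ℂ-trans (*ℂ-distribˡ-+ x y z) (+ℂ-cong (*ℂ-comm x y) (*ℂ-comm x z)))
      }
    ; *-comm = *ℂ-comm
    }

  ℂ-heytingField : HeytingField 0ℓ 0ℓ 0ℓ
  ℂ-heytingField = record
    { Carrier = ℂ ; _≈_ = _≈ℂ_ ; _#_ = _#ℂ_ ; _+_ = _+ℂ_ ; _*_ = _*ℂ_ ; -_ = -ℂ_
    ; 0# = 0ℂ ; 1# = 1ℂ
    ; isHeytingField = record
      { isHeytingCommutativeRing = record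
        { isCommutativeRing = ℂ-isCommutativeRing
        ; isApartnessRelation = record
          { irrefl = #ℂ⇒≉ ; sym = Sum.map R.#-sym R.#-sym ; cotrans = #ℂ-cotrans }
        ; #⇒invertible = λ {x} {y} x#y → let w , p = #ℂ⇒inverse x#y in
            w , p , ≈ℂ-trans (*ℂ-comm (x -ℂ y) w) p
        ; invertible⇒# = λ (w , p , _) → inverse⇒#ℂ (w , p)
        }
      ; tight = λ x y → #ℂ-tight , #ℂ⇒≉
      }
    }

module LaurentSeries {c ℓ₁ ℓ₂} (K : HeytingField c ℓ₁ ℓ₂) where

  private
    module K where
      open HeytingField K public
      open CommutativeRing (HeytingCommutativeRing.commutativeRing heytingCommutativeRing) public
        using (ring; rawRing)
      open RawSemiringDefs (RawRing.rawSemiring rawRing) public using (_^_; sum)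

  record Laurent : Set (c ⊔ ℓ₁) where
    field
      coeff : ℤ → K.Carrier
      lower : ℤ
      below : ∀ {k} → k ℤ.< lower → coeff k K.≈ K.0#

  open Laurent public

  infix 4 _≈_

  record _≈_ (f g : Laurent) : Set ℓ₁ where
    constructor mk≈
    field
      coeff-≈ : ∀ k → coeff f k K.≈ coeff g k

  open _≈_ public

  extend : (ℕ → K.Carrier) → ℤ → K.Carrier
  extend u (+ m)    = u m
  extend u -[1+ _ ] = K.0#

  extend-below : ∀ u {k N} → k ℤ.< N → extend u (k ℤ.- N) K.≈ K.0#
  extend-below u {k} {N} k<N =
    negative (subst (k ℤ.- N ℤ.<_) (ℤₚ.+-inverseʳ N) (ℤₚ.+-monoˡ-< (ℤ.- N) k<N))
    where
    negative : ∀ {i} → i ℤ.< + 0 → extend u i K.≈ K.0#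
    negative { -[1+ _ ]} _ = K.refl
    negative {+ _} (ℤ.+<+ ())

  -- x^N ∑_{m ≥ 0} u_m x^m
  series : ℤ → (ℕ → K.Carrier) → Laurent
  series N u = record
    { coeff = λ k → extend u (k ℤ.- N)
    ; lower = N
    ; below = extend-below u
    }

  infixl 6 _+_
  infixl 7 _*_
  infix  8 -_

  _+_ : Laurent → Laurent → Laurent
  f + g = record
    { coeff = λ k → coeff f k K.+ coeff g k
    ; lower = lower f ℤ.⊓ lower g
    ; below = λ k<N → K.trans
        (K.+-cong (below f (ℤₚ.<-≤-trans k<N (ℤₚ.i⊓j≤i (lower f) (lower g))))
                  (below g (ℤₚ.<-≤-trans k<N (ℤₚ.i⊓j≤j (lower f) (lower g)))))
        (K.+-identityˡ K.0#)
    }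

  -_ : Laurent → Laurent
  - f = record
    { coeff = λ k → K.- coeff f k
    ; lower = lower f
    ; below = λ k<N → K.trans (K.-‿cong (below f k<N)) -0#≈0#
    }
    where open import Algebra.Properties.Ring K.ring using (-0#≈0#)

  _*_ : Laurent → Laurent → Laurent
  f * g = series (lower f ℤ.+ lower g) λ m → K.sum {suc m} λ i →
    coeff f (lower f ℤ.+ + toℕ i) K.* coeff g (lower g ℤ.+ + (m ℕ.∸ toℕ i))

  0# : Laurent
  0# = series (+ 0) λ _ → K.0#

  unit : ℕ → K.Carrier
  unit zero    = K.1#
  unit (suc _) = K.0#

  1# : Laurent
  1# = series (+ 0) unit

  rawRing : RawRing (c ⊔ ℓ₁) ℓ₁
  rawRing = record
    { Carrier = Laurent ; _≈_ = _≈_ ; _+_ = _+_ ; _*_ = _*_ ; -_ = -_ ; 0# = 0# ; 1# = 1# }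

  open RawSemiringDefs (RawRing.rawSemiring rawRing) public using (_^_; sum)

  -- An element of K is nonzero if it is apart from 0; a Laurent series is nonzero if it
  -- has a leading coefficient.  Classically this is the negation of f ≈ 0#.
  infix 4 _≠0

  _≠0 : Laurent → Set (ℓ₁ ⊔ ℓ₂)
  f ≠0 = ∃[ n ] coeff f n K.# K.0# × (∀ k → k ℤ.< n → coeff f k K.≈ K.0#)

  ≠0⇔≉0 : ExcludedMiddle ℓ₂ → ∀ f → f ≠0 ⇔ (¬ f ≈ 0#)
  ≠0⇔≉0 em f = mk⇔ to from
    where
    a : ℕ → K.Carrier
    a j = coeff f (lower f ℤ.+ + j)

    0#-coeff : ∀ k → coeff 0# k K.≈ K.0#
    0#-coeff k with k ℤ.- + 0
    ... | + _      = K.refl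
    ... | -[1+ _ ] = K.refl

    to : f ≠0 → ¬ (f ≈ 0#)
    to (n , fₙ#0 , _) f≈0 = K.#-irrefl (K.trans (coeff-≈ f≈0 n) (0#-coeff n)) fₙ#0

    above : ∀ {k} → lower f ℤ.≤ k → ∃[ j ] k ≡ lower f ℤ.+ + j
    above {k} le = ℤ.∣ k ℤ.- lower f ∣ , sym (trans
      (cong (λ i → lower f ℤ.+ i) (ℤₚ.0≤i⇒+∣i∣≡i (ℤₚ.i≤j⇒0≤j-i le)))
      (trans (ℤₚ.+-comm (lower f) (k ℤ.- lower f))
        (trans (ℤₚ.+-assoc k (ℤ.- lower f) (lower f))
          (trans (cong (λ i → k ℤ.+ i) (ℤₚ.+-inverseˡ (lower f))) (ℤₚ.+-identityʳ k)))))

    vanishes : ∀ n → (∀ j → j ℕ.< n → a j K.≈ K.0#) →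
               ∀ k → k ℤ.< lower f ℤ.+ + n → coeff f k K.≈ K.0#
    vanishes n a≈0 k k<n with k ℤₚ.<? lower f
    ... | yes k<l = below f k<l
    ... | no  k≮l with above (ℤₚ.≮⇒≥ k≮l)
    ... | j , refl = a≈0 j
      (ℕₚ.≰⇒> λ n≤j → ℤₚ.<⇒≱ k<n (ℤₚ.+-monoʳ-≤ (lower f) (ℤ.+≤+ n≤j)))

    search : ∀ d n → (∀ j → j ℕ.< n → a j K.≈ K.0#) → a (n ℕ.+ d) K.# K.0# → f ≠0
    search d n a≈0 a#0 with em {a n K.# K.0#}
    ... | yes aₙ#0 = lower f ℤ.+ + n , aₙ#0 , vanishes n a≈0
    search zero n a≈0 a#0 | no ¬aₙ#0 =
      ⊥-elim (¬aₙ#0 (subst (λ i → a i K.# K.0#) (ℕₚ.+-identityʳ n) a#0))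
    search (suc d) n a≈0 a#0 | no ¬aₙ#0 =
      search d (suc n) step (subst (λ i → a i K.# K.0#) (ℕₚ.+-suc n d) a#0)
      where
      step : ∀ j → j ℕ.< suc n → a j K.≈ K.0#
      step j j<1+n with ℕₚ.m<1+n⇒m<n∨m≡n j<1+n
      ... | inj₁ j<n  = a≈0 j j<n
      ... | inj₂ refl = proj₁ (K.tight (a n) K.0#) ¬aₙ#0

    from : ¬ (f ≈ 0#) → f ≠0
    from f≉0 with em {∃[ j ] a j K.# K.0#}
    ... | yes (j , aⱼ#0) = search j 0 (λ _ ()) aⱼ#0
    ... | no  ¬∃ = ⊥-elim (f≉0 (mk≈ λ k → K.trans (f≈0 k) (K.sym (0#-coeff k))))
      where
      f≈0 : ∀ k → coeff f k K.≈ K.0#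
      f≈0 k with k ℤₚ.<? lower f
      ... | yes k<l = below f k<l
      ... | no  k≮l with above (ℤₚ.≮⇒≥ k≮l)
      ... | j , refl = proj₁ (K.tight (a j) K.0#) (λ aⱼ#0 → ¬∃ (j , aⱼ#0))

  inv : (a : K.Carrier) → a K.# K.0# → K.Carrier
  inv a a#0 = proj₁ (K.#⇒invertible a#0)

  -- If u_0 has the inverse w, then the inverse of ∑ u_m x^m is ∑ v_m x^m with v_0 = w and
  -- v_k = - w (u_1 v_{k-1} + ⋯ + u_k v_0).
  module PowerSeriesInverse (u : ℕ → K.Carrier) (w : K.Carrier) where

    next : ∀ k → Vector K.Carrier k → K.Carrier
    next zero    _  = w
    next (suc k) vs = K.- (w K.* K.sum {suc k} λ i → u (suc (toℕ i)) K.* vs i)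

    -- The coefficients v_{k-1}, …, v_0, in this order.
    previous : ∀ k → Vector K.Carrier k
    previous zero    = []
    previous (suc k) = next k (previous k) ∷ previous k

    v : ℕ → K.Carrier
    v k = next k (previous k)

  1/ : (f : Laurent) → f ≠0 → Laurent
  1/ f (n , fₙ#0 , _) = series (ℤ.- n) v
    where open PowerSeriesInverse (λ m → coeff f (n ℤ.+ + m)) (inv (coeff f n) fₙ#0)

  power : (q : K.Carrier) → q K.# K.0# → ℤ → K.Carrier
  power q q#0 (+ n)      = q K.^ n
  power q q#0 (-[1+ n ]) = inv q q#0 K.^ suc n

  Operator : Set (c ⊔ ℓ₁)
  Operator = Laurent → Laurent

  open Function.Endo.Propositional Laurent public using () renaming (_^_ to _^ᵒ_)

  infixl 6 _-ᵒ_

  _-ᵒ_ : Operator → Operator → Operator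
  (A -ᵒ B) g = A g + - B g

  mul : Laurent → Operator
  mul a g = a * g

  module _ (q : K.Carrier) (q#0 : q K.# K.0#) where

    σ : Operator
    σ f = record
      { coeff = λ k → power q q#0 k K.* coeff f k
      ; lower = lower f
      ; below = λ k<N → K.trans (K.*-congˡ (below f k<N)) (K.zeroʳ _)
      }

    βₛ : (α β : Laurent) → ℕ → Laurent
    βₛ α β j = sum {j} λ k → ((mul (- α) ∘ σ) ^ᵒ toℕ k) β

    -- The operator (1/β_{n+1-i}) (α^i σ - (-1)^i) for i = k + 1.
    factor : (n : ℕ) (α β : Laurent) → (∀ j → 0 ℕ.< j → j ℕ.≤ n → βₛ α β j ≠0) → Fin n → Operator
    factor n α β β≠0 k =
      mul (1/ (βₛ α β (n ℕ.∸ toℕ k))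
              (β≠0 (n ℕ.∸ toℕ k) (ℕₚ.m<n⇒0<n∸m (toℕ<n k)) (ℕₚ.m∸n≤m n (toℕ k))))
      ∘ (mul (α ^ suc (toℕ k)) ∘ σ -ᵒ mul ((- 1#) ^ suc (toℕ k)))

    L : (n : ℕ) (α β : Laurent) → (∀ j → 0 ℕ.< j → j ℕ.≤ n → βₛ α β j ≠0) → Operator
    L n α β β≠0 = foldr _∘′_ id (factor n α β β≠0)

open Complexes using (ℂ) renaming (ℂ-heytingField to ℂ-field) public
open HeytingField ℂ-field using () renaming (_#_ to _#ℂ_; 0# to 0ℂ) public
open LaurentSeries ℂ-field public

{-# OPTIONS --safe #-}

-- Put a_j = β_j − f, so that a_0 = −f.  The recursion β_{j+1} = β − α σ β_j and the equation
-- α σ f + f = β give α σ a_j = −a_{j+1}.  Hence for the complete homogeneous symmetric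
-- polynomial h_m in the j variables a_0, …, a_{j−1},
--   (α^m σ − (−1)^m) h_m(a_0, …, a_{j−1})
--     = (−1)^m (h_m(a_1, …, a_j) − h_m(a_0, …, a_{j−1}))
--     = (−1)^m (a_j − a_0) h_{m−1}(a_0, …, a_j),
-- and a_j − a_0 = β_j is exactly what the next factor 1/β_j cancels.  Starting from
-- f^n = (−1)^n h_n(a_0), the n factors of L successively lower the degree and end at
-- (−1)^n ∏_{m ≤ n} (−1)^m = (−1)^{n(n−1)/2}.
module Submission where

open import Algebra.Apartness.Bundles using (HeytingCommutativeRing; HeytingField)
open import Algebra.Bundles using (CommutativeRing; Semiring)
open import Algebra.Morphism.Structures using (module RingMorphisms)
open import Algebra.Structures using (IsCommutativeRing)
open import Data.Fin.Base using (Fin; zero; suc; toℕ)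
open import Data.Fin.Properties using (toℕ<n)
open import Data.Integer.Base as ℤ using (ℤ; +_; -[1+_])
import Data.Integer.Properties as ℤₚ
open import Data.Integer.Solver using () renaming (module +-*-Solver to ℤ-Solver)
open import Data.Nat.Base as ℕ using (ℕ; zero; suc; _∸_; _/_)
open import Data.Nat.Divisibility using (n∣m*n)
open import Data.Nat.DivMod using (+-distrib-/-∣ʳ; m*n/n≡m)
import Data.Nat.Properties as ℕₚ
open import Data.Nat.Solver using () renaming (module +-*-Solver to ℕ-Solver)
open import Data.Product.Base using (∃-syntax; _,_; proj₂)
open import Data.Vec.Functional using (Vector; foldr)
open import Function.Base using (_∘_; _∘′_; id)
open import Level using (_⊔_)
open import Relation.Binary.PropositionalEquality as ≡ using (_≡_)
open import Relation.Nullary using (yes; no)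

import Algebra.Definitions.RawSemiring as RawSemiringDefs
import Algebra.Solver.Ring.NaturalCoefficients.Default as SemiringSolver
import Function.Endo.Propositional
import Relation.Binary.Reasoning.Setoid as SetoidReasoning

open import Defs using (module LaurentSeries)

-- Cauchy products of coefficient sequences.

module CauchyProduct {c ℓ} (R : CommutativeRing c ℓ) where

  open CommutativeRing R hiding (zero)
  open RawSemiringDefs (Semiring.rawSemiring semiring) using (sum; _^_)
  open SetoidReasoning setoid
  open SemiringSolver commutativeSemiring using (solve; con; _:=_; _:+_; _:*_)

  infix  4 _≋_
  infixl 7 _⋆_

  _≋_ : (u v : ℕ → Carrier) → Set ℓ
  u ≋ v = ∀ m → u m ≈ v m

  _⋆_ : (u v : ℕ → Carrier) → ℕ → Carrier
  (u ⋆ v) m = sum {suc m} λ i → u (toℕ i) * v (m ∸ toℕ i)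

  ⋆-cong : ∀ {u u′ v v′} → u ≋ u′ → v ≋ v′ → u ⋆ v ≋ u′ ⋆ v′
  ⋆-cong p q zero    = +-congʳ (*-cong (p 0) (q 0))
  ⋆-cong p q (suc m) = +-cong (*-cong (p 0) (q (suc m))) (⋆-cong (p ∘ suc) q m)

  -- By computation only the first term `u 0 * v (suc m)` splits off. Splitting off the last one
  -- instead is what reversing the sum in `⋆-comm` requires.
  ⋆-tailʳ : ∀ u v m → (u ⋆ v) (suc m) ≈ u (suc m) * v 0 + (u ⋆ (v ∘ suc)) m
  ⋆-tailʳ u v zero = solve 3 (λ x y z → x :+ (y :+ z) := y :+ (x :+ z)) refl
    (u 0 * v 1) (u 1 * v 0) 0#
  ⋆-tailʳ u v (suc m) = begin
    u 0 * v (2 ℕ.+ m) + ((u ∘ suc) ⋆ v) (suc m)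
      ≈⟨ +-congˡ (⋆-tailʳ (u ∘ suc) v m) ⟩
    u 0 * v (2 ℕ.+ m) + (u (2 ℕ.+ m) * v 0 + ((u ∘ suc) ⋆ (v ∘ suc)) m)
      ≈⟨ solve 3 (λ x y z → x :+ (y :+ z) := y :+ (x :+ z)) refl _ _ _ ⟩
    u (2 ℕ.+ m) * v 0 + (u 0 * v (2 ℕ.+ m) + ((u ∘ suc) ⋆ (v ∘ suc)) m) ∎

  ⋆-comm : ∀ u v → u ⋆ v ≋ v ⋆ u
  ⋆-comm u v zero    = +-congʳ (*-comm (u 0) (v 0))
  ⋆-comm u v (suc m) = trans (+-cong (*-comm (u 0) (v (suc m))) (⋆-comm (u ∘ suc) v m))
                             (sym (⋆-tailʳ v u m))

  ⋆-distribʳ-+ : ∀ w u v → (λ i → u i + v i) ⋆ w ≋ λ m → (u ⋆ w) m + (v ⋆ w) m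
  ⋆-distribʳ-+ w u v zero = solve 3
    (λ x y z → (x :+ y) :* z :+ con 0 := x :* z :+ con 0 :+ (y :* z :+ con 0)) refl
    (u 0) (v 0) (w 0)
  ⋆-distribʳ-+ w u v (suc m) = begin
    (u 0 + v 0) * w (suc m) + ((λ i → u (suc i) + v (suc i)) ⋆ w) m
      ≈⟨ +-congˡ (⋆-distribʳ-+ w (u ∘ suc) (v ∘ suc) m) ⟩
    (u 0 + v 0) * w (suc m) + (((u ∘ suc) ⋆ w) m + ((v ∘ suc) ⋆ w) m)
      ≈⟨ solve 5 (λ a b c d e → (a :+ b) :* c :+ (d :+ e) := a :* c :+ d :+ (b :* c :+ e))
           refl (u 0) (v 0) (w (suc m)) _ _ ⟩
    (u ⋆ w) (suc m) + (v ⋆ w) (suc m) ∎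

  ⋆-scaleˡ : ∀ a u v → (λ i → a * u i) ⋆ v ≋ λ m → a * (u ⋆ v) m
  ⋆-scaleˡ a u v zero = trans (+-cong (*-assoc a (u 0) (v 0)) (sym (zeroʳ a)))
    (sym (distribˡ a (u 0 * v 0) 0#))
  ⋆-scaleˡ a u v (suc m) = trans
    (+-cong (*-assoc a (u 0) (v (suc m))) (⋆-scaleˡ a (u ∘ suc) v m))
    (sym (distribˡ a (u 0 * v (suc m)) (((u ∘ suc) ⋆ v) m)))

  ⋆-scale : ∀ a b u v → (λ i → a * u i) ⋆ (λ i → b * v i) ≋ λ m → a * (b * (u ⋆ v) m)
  ⋆-scale a b u v m = begin
    ((λ i → a * u i) ⋆ (λ i → b * v i)) m ≈⟨ ⋆-scaleˡ a u (λ i → b * v i) m ⟩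
    a * (u ⋆ (λ i → b * v i)) m           ≈⟨ *-congˡ (⋆-comm u (λ i → b * v i) m) ⟩
    a * ((λ i → b * v i) ⋆ u) m           ≈⟨ *-congˡ (⋆-scaleˡ b v u m) ⟩
    a * (b * (v ⋆ u) m)                   ≈⟨ *-congˡ (*-congˡ (⋆-comm v u m)) ⟩
    a * (b * (u ⋆ v) m)                   ∎

  -- Every term of the product at `m` carries q^i q^(m-i) = q^m. This is the power series core of
  -- the multiplicativity of `σ`.
  ⋆-dilate : ∀ q u v → (λ i → q ^ i * u i) ⋆ (λ i → q ^ i * v i) ≋ λ m → q ^ m * (u ⋆ v) m
  ⋆-dilate q u v zero = trans (+-congʳ (*-cong (*-identityˡ (u 0)) (*-identityˡ (v 0))))
    (sym (*-identityˡ (u 0 * v 0 + 0#)))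
  ⋆-dilate q u v (suc m) = begin
    1# * u 0 * (q * q ^ m * v (suc m)) + ((λ i → q * q ^ i * u (suc i)) ⋆ (λ i → q ^ i * v i)) m
      ≈⟨ +-congˡ (⋆-cong {v = λ i → q ^ i * v i} (λ i → *-assoc q (q ^ i) (u (suc i))) (λ _ → refl) m) ⟩
    1# * u 0 * (q * q ^ m * v (suc m)) +
      ((λ i → q * (q ^ i * u (suc i))) ⋆ (λ i → q ^ i * v i)) m
      ≈⟨ +-cong (*-congʳ (*-identityˡ (u 0)))
           (trans (⋆-scaleˡ q (λ i → q ^ i * u (suc i)) (λ i → q ^ i * v i) m)
                  (*-congˡ (⋆-dilate q (u ∘ suc) v m))) ⟩
    u 0 * (q * q ^ m * v (suc m)) + q * (q ^ m * ((u ∘ suc) ⋆ v) m)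
      ≈⟨ solve 5 (λ a b q p d → a :* (q :* p :* b) :+ q :* (p :* d) := q :* p :* (a :* b :+ d))
           refl (u 0) (v (suc m)) q (q ^ m) _ ⟩
    q * q ^ m * (u ⋆ v) (suc m) ∎

  -- (u ⋆ v) ∘ suc = u 0 · (v ∘ suc) + (u ∘ suc) ⋆ v holds by computation.
  ⋆-assoc : ∀ u v w → (u ⋆ v) ⋆ w ≋ u ⋆ (v ⋆ w)
  ⋆-assoc u v w zero = solve 3
    (λ x y z → (x :* y :+ con 0) :* z :+ con 0 := x :* (y :* z :+ con 0) :+ con 0) refl
    (u 0) (v 0) (w 0)
  ⋆-assoc u v w (suc m) = begin
    (u 0 * v 0 + 0#) * w (suc m) + ((λ i → u 0 * v (suc i) + ((u ∘ suc) ⋆ v) i) ⋆ w) m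
      ≈⟨ +-cong (*-congʳ (+-identityʳ (u 0 * v 0)))
           (⋆-distribʳ-+ w (λ i → u 0 * v (suc i)) ((u ∘ suc) ⋆ v) m) ⟩
    u 0 * v 0 * w (suc m) + (((λ i → u 0 * v (suc i)) ⋆ w) m + (((u ∘ suc) ⋆ v) ⋆ w) m)
      ≈⟨ +-congˡ (+-cong (⋆-scaleˡ (u 0) (v ∘ suc) w m) (⋆-assoc (u ∘ suc) v w m)) ⟩
    u 0 * v 0 * w (suc m) + (u 0 * ((v ∘ suc) ⋆ w) m + ((u ∘ suc) ⋆ (v ⋆ w)) m)
      ≈⟨ solve 5 (λ a b c d e → a :* b :* c :+ (a :* d :+ e) := a :* (b :* c :+ d) :+ e)
           refl (u 0) (v 0) (w (suc m)) _ _ ⟩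
    (u ⋆ (v ⋆ w)) (suc m) ∎

  ⋆-zeroˡ : ∀ {u} v → u ≋ (λ _ → 0#) → u ⋆ v ≋ λ _ → 0#
  ⋆-zeroˡ v p zero    = trans (+-identityʳ _) (trans (*-congʳ (p 0)) (zeroˡ (v 0)))
  ⋆-zeroˡ v p (suc m) = trans (+-cong (trans (*-congʳ (p 0)) (zeroˡ (v (suc m))))
    (⋆-zeroˡ v (p ∘ suc) m)) (+-identityˡ 0#)

  ⋆-identityˡ : ∀ {u} v → u 0 ≈ 1# → (∀ m → u (suc m) ≈ 0#) → u ⋆ v ≋ v
  ⋆-identityˡ v p q zero    = trans (+-identityʳ _) (trans (*-congʳ p) (*-identityˡ (v 0)))
  ⋆-identityˡ v p q (suc m) = trans (+-cong (trans (*-congʳ p) (*-identityˡ (v (suc m))))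
    (⋆-zeroˡ v q m)) (+-identityʳ (v (suc m)))

  -- Multiplication by x^j: the same series, read from an exponent lower by `j`.
  pad : ℕ → (ℕ → Carrier) → ℕ → Carrier
  pad zero    u m       = u m
  pad (suc j) u zero    = 0#
  pad (suc j) u (suc m) = pad j u m

  pad-⋆ : ∀ j k u v → pad j u ⋆ pad k v ≋ pad (j ℕ.+ k) (u ⋆ v)
  pad-⋆ zero    zero    u v m       = refl
  pad-⋆ zero    (suc k) u v zero    = trans (+-identityʳ _) (zeroʳ (u 0))
  pad-⋆ zero    (suc k) u v (suc m) = trans (⋆-tailʳ u (pad (suc k) v) m)
    (trans (+-cong (zeroʳ (u (suc m))) (pad-⋆ zero k u v m)) (+-identityˡ _))
  pad-⋆ (suc j) k       u v zero    = trans (+-identityʳ _) (zeroˡ (pad k v 0))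
  pad-⋆ (suc j) k       u v (suc m) =
    trans (+-cong (zeroˡ (pad k v (suc m))) (pad-⋆ j k u v m)) (+-identityˡ _)

-- The commutative ring of Laurent series.

≤⇒offset : ∀ {i j} → i ℤ.≤ j → ∃[ n ] j ≡ i ℤ.+ + n
≤⇒offset {i} {j} i≤j = ℤ.∣ j ℤ.- i ∣ , ≡.trans
  (solve 2 (λ i j → j := i :+ (j :- i)) ≡.refl i j)
  (≡.cong (λ k → i ℤ.+ k) (≡.sym (ℤₚ.0≤i⇒+∣i∣≡i (ℤₚ.i≤j⇒0≤j-i i≤j))))
  where open ℤ-Solver

module LaurentRing {c ℓ₁ ℓ₂} (K : HeytingField c ℓ₁ ℓ₂) where

  open LaurentSeries K

  coefficientRing : CommutativeRing c ℓ₁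
  coefficientRing = HeytingCommutativeRing.commutativeRing (HeytingField.heytingCommutativeRing K)

  private
    module K where
      open CommutativeRing coefficientRing public

  open CauchyProduct coefficientRing

  -- f = x^N ∑ u_m x^m, where N may be smaller than lower f or than the order of f.
  record HasSeries (f : Laurent) (N : ℤ) (u : ℕ → K.Carrier) : Set ℓ₁ where
    constructor hasSeries
    field
      vanishes : ∀ {k} → k ℤ.< N → coeff f k K.≈ K.0#
      at       : ∀ m → coeff f (N ℤ.+ + m) K.≈ u m

  open HasSeries

  lowerSeries : Laurent → ℕ → K.Carrier
  lowerSeries f m = coeff f (lower f ℤ.+ + m)

  lower-hasSeries : ∀ f → HasSeries f (lower f) (lowerSeries f)
  lower-hasSeries f = hasSeries (below f) λ _ → K.refl

  series-hasSeries : ∀ N u → HasSeries (series N u) N u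
  series-hasSeries N u = hasSeries (extend-below u) λ m → K.reflexive (≡.cong (extend u)
    (solve 2 (λ N m → N :+ m :- N := m) ≡.refl N (+ m)))
    where open ℤ-Solver

  weaken : ∀ {f N} → N ℤ.≤ lower f → HasSeries f N (λ m → coeff f (N ℤ.+ + m))
  weaken {f} N≤l = hasSeries (λ k<N → below f (ℤₚ.<-≤-trans k<N N≤l)) λ _ → K.refl

  reindex : ∀ {f N M u} → N ≡ M → HasSeries f N u → HasSeries f M u
  reindex ≡.refl F = F

  hasSeries-resp-≋ : ∀ {f N u v} → u ≋ v → HasSeries f N u → HasSeries f N v
  hasSeries-resp-≋ p F = hasSeries (vanishes F) λ m → K.trans (at F m) (p m)

  hasSeries-resp-≈ : ∀ {f g N u} → f ≈ g → HasSeries f N u → HasSeries g N u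
  hasSeries-resp-≈ p F = hasSeries (λ {k} k<N → K.trans (K.sym (coeff-≈ p k)) (vanishes F k<N))
    λ m → K.trans (K.sym (coeff-≈ p _)) (at F m)

  hasSeries-unique : ∀ {f N u v} → HasSeries f N u → HasSeries f N v → u ≋ v
  hasSeries-unique F F′ m = K.trans (K.sym (at F m)) (at F′ m)

  -- Reduces an identity of Laurent series to one of sequences with a common start; the
  -- multiplicative ring laws below are thus inherited from those of `⋆`.
  hasSeries⇒≈ : ∀ {f g N u v} → HasSeries f N u → HasSeries g N v → u ≋ v → f ≈ g
  hasSeries⇒≈ {f} {g} {N} F G p = mk≈ eq
    where
    eq : ∀ k → coeff f k K.≈ coeff g k
    eq k with k ℤₚ.<? N
    ... | yes k<N = K.trans (vanishes F k<N) (K.sym (vanishes G k<N))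
    ... | no  k≮N with ≤⇒offset (ℤₚ.≮⇒≥ k≮N)
    ... | m , ≡.refl = K.trans (at F m) (K.trans (p m) (K.sym (at G m)))

  private
    suc-shift : ∀ N m → ℤ.suc N ℤ.+ + m ≡ N ℤ.+ + suc m
    suc-shift N m = solve 2 (λ N m → con (+ 1) :+ N :+ m := N :+ (con (+ 1) :+ m)) ≡.refl N (+ m)
      where open ℤ-Solver

    <⇒<suc : ∀ {k N} → k ℤ.< N → k ℤ.< ℤ.suc N
    <⇒<suc {N = N} k<N = ℤₚ.<-≤-trans k<N (ℤₚ.i≤suc[i] N)

    N<sucN : ∀ N → N ℤ.< ℤ.suc N
    N<sucN N = ℤₚ.suc[i]≤j⇒i<j ℤₚ.≤-refl

    <suc⇒≤ : ∀ {k N} → k ℤ.< ℤ.suc N → k ℤ.≤ N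
    <suc⇒≤ {k} {N} k<sN = ≡.subst (k ℤ.≤_) (ℤₚ.pred-suc N) (ℤₚ.i<j⇒i≤pred[j] k<sN)

  shift-down : ∀ {f} N j {u} → HasSeries f (N ℤ.+ + j) u → HasSeries f N (pad j u)
  shift-down {f} N zero {u} F = reindex (ℤₚ.+-identityʳ N) F
  shift-down {f} N (suc j) {u} F = hasSeries (vanishes G ∘ <⇒<suc) λ where
      zero    → vanishes G (≡.subst (ℤ._< ℤ.suc N) (≡.sym (ℤₚ.+-identityʳ N)) (N<sucN N))
      (suc m) → K.trans (K.reflexive (≡.cong (coeff f) (≡.sym (suc-shift N m)))) (at G m)
    where
    G : HasSeries f (ℤ.suc N) (pad j u)
    G = shift-down (ℤ.suc N) j (reindex (≡.sym (suc-shift N j)) F)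

  shift-up : ∀ {f} N j {u} → HasSeries f N (pad j u) → HasSeries f (N ℤ.+ + j) u
  shift-up {f} N zero {u} F = reindex (≡.sym (ℤₚ.+-identityʳ N)) F
  shift-up {f} N (suc j) {u} F = reindex (suc-shift N j)
    (shift-up (ℤ.suc N) j (hasSeries vanish λ m →
      K.trans (K.reflexive (≡.cong (coeff f) (suc-shift N m))) (at F (suc m))))
    where
    vanish : ∀ {k} → k ℤ.< ℤ.suc N → coeff f k K.≈ K.0#
    vanish {k} k<sN with k ℤₚ.≟ N
    ... | no  k≢N   = vanishes F (ℤₚ.≤∧≢⇒< (<suc⇒≤ k<sN) k≢N)
    -- The one new exponent `N` is covered by the zero at the head of the padded sequence.
    ... | yes ≡.refl = K.trans (K.reflexive (≡.cong (coeff f) (≡.sym (ℤₚ.+-identityʳ k)))) (at F 0)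

  +-hasSeries : ∀ {f g N u v} → HasSeries f N u → HasSeries g N v →
                HasSeries (f + g) N (λ m → u m K.+ v m)
  +-hasSeries F G = hasSeries
    (λ k<N → K.trans (K.+-cong (vanishes F k<N) (vanishes G k<N)) (K.+-identityˡ K.0#))
    λ m → K.+-cong (at F m) (at G m)

  -- The product is defined through the windows at lower f and lower g; padding all windows
  -- with zeros down to common lower ends shows that it does not depend on this choice.
  *-hasSeries : ∀ {f g N M u v} → HasSeries f N u → HasSeries g M v →
                HasSeries (f * g) (N ℤ.+ M) (u ⋆ v)
  *-hasSeries {f} {g} {N} {M} {u} {v} F G
    with ≤⇒offset (ℤₚ.i⊓j≤i N (lower f)) | ≤⇒offset (ℤₚ.i⊓j≤j N (lower f))
       | ≤⇒offset (ℤₚ.i⊓j≤i M (lower g)) | ≤⇒offset (ℤₚ.i⊓j≤j M (lower g))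
  ... | j , N≡ | j′ , l≡ | k , M≡ | k′ , l′≡ =
    reindex
      (≡.trans (interchange N₀ j M₀ k) (≡.cong₂ ℤ._+_ (≡.sym N≡) (≡.sym M≡)))
      (shift-up (N₀ ℤ.+ M₀) (j ℕ.+ k) (hasSeries-resp-≋ pads
        (shift-down (N₀ ℤ.+ M₀) (j′ ℕ.+ k′)
          (reindex
            (≡.trans (≡.cong₂ ℤ._+_ l≡ l′≡) (≡.sym (interchange N₀ j′ M₀ k′)))
            (series-hasSeries (lower f ℤ.+ lower g) (lowerSeries f ⋆ lowerSeries g))))))
    where
    N₀ M₀ : ℤ
    N₀ = N ℤ.⊓ lower f
    M₀ = M ℤ.⊓ lower g
    interchange : ∀ N j M k → N ℤ.+ M ℤ.+ + (j ℕ.+ k) ≡ N ℤ.+ + j ℤ.+ (M ℤ.+ + k)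
    interchange N j M k =
      solve 4 (λ N j M k → N :+ M :+ (j :+ k) := N :+ j :+ (M :+ k)) ≡.refl N (+ j) M (+ k)
      where open ℤ-Solver
    -- Both padded sequences are the coefficients of `h` read from the same exponent `N₀`.
    common : ∀ {h N w} N₀ j j′ → N ≡ N₀ ℤ.+ + j → lower h ≡ N₀ ℤ.+ + j′ →
             HasSeries h N w → pad j′ (lowerSeries h) ≋ pad j w
    common {h} N₀ j j′ p q H = hasSeries-unique
      (shift-down N₀ j′ (reindex q (lower-hasSeries h)))
      (shift-down N₀ j (reindex p H))
    pads : pad (j′ ℕ.+ k′) (lowerSeries f ⋆ lowerSeries g) ≋ pad (j ℕ.+ k) (u ⋆ v)
    pads m = K.trans (K.sym (pad-⋆ j′ k′ (lowerSeries f) (lowerSeries g) m))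
      (K.trans (⋆-cong (common N₀ j j′ N≡ l≡ F) (common M₀ k k′ M≡ l′≡ G) m)
        (pad-⋆ j k u v m))

  coeff-0# : ∀ k → coeff 0# k K.≈ K.0#
  coeff-0# k with k ℤ.- + 0
  ... | + _      = K.refl
  ... | -[1+ _ ] = K.refl

  *-cong : ∀ {f f′ g g′} → f ≈ f′ → g ≈ g′ → f * g ≈ f′ * g′
  *-cong {f} {f′} {g} {g′} p q = hasSeries⇒≈
    (*-hasSeries (lower-hasSeries f) (lower-hasSeries g))
    (*-hasSeries (hasSeries-resp-≈ p (lower-hasSeries f)) (hasSeries-resp-≈ q (lower-hasSeries g)))
    λ _ → K.refl

  *-comm : ∀ f g → f * g ≈ g * f
  *-comm f g = hasSeries⇒≈
    (*-hasSeries (lower-hasSeries f) (lower-hasSeries g))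
    (reindex (ℤₚ.+-comm (lower g) (lower f))
      (*-hasSeries (lower-hasSeries g) (lower-hasSeries f)))
    (⋆-comm (lowerSeries f) (lowerSeries g))

  *-assoc : ∀ f g h → (f * g) * h ≈ f * (g * h)
  *-assoc f g h = hasSeries⇒≈
    (reindex (ℤₚ.+-assoc (lower f) (lower g) (lower h))
      (*-hasSeries (*-hasSeries F G) H))
    (*-hasSeries F (*-hasSeries G H))
    (⋆-assoc (lowerSeries f) (lowerSeries g) (lowerSeries h))
    where
    F = lower-hasSeries f
    G = lower-hasSeries g
    H = lower-hasSeries h

  *-identityˡ : ∀ f → 1# * f ≈ f
  *-identityˡ f = hasSeries⇒≈
    (reindex (ℤₚ.+-identityˡ (lower f))
      (*-hasSeries (series-hasSeries (+ 0) unit) (lower-hasSeries f)))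
    (lower-hasSeries f)
    (⋆-identityˡ {unit} (lowerSeries f) K.refl λ _ → K.refl)

  *-distribʳ-+ : ∀ f g h → (g + h) * f ≈ g * f + h * f
  *-distribʳ-+ f g h = hasSeries⇒≈
    (*-hasSeries (+-hasSeries G H) F)
    (+-hasSeries (*-hasSeries G F) (*-hasSeries H F))
    (⋆-distribʳ-+ (lowerSeries f) (λ m → coeff g (N ℤ.+ + m)) (λ m → coeff h (N ℤ.+ + m)))
    where
    F = lower-hasSeries f
    N = lower g ℤ.⊓ lower h
    -- Both summands are read from the common start `N`, so that they add termwise.
    G = weaken {g} (ℤₚ.i⊓j≤i (lower g) (lower h))
    H = weaken {h} (ℤₚ.i⊓j≤j (lower g) (lower h))

  private
    ≈-trans : ∀ {f g h} → f ≈ g → g ≈ h → f ≈ h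
    ≈-trans p q = mk≈ λ k → K.trans (coeff-≈ p k) (coeff-≈ q k)

    +-comm : ∀ f g → f + g ≈ g + f
    +-comm f g = mk≈ λ k → K.+-comm (coeff f k) (coeff g k)

    +-cong : ∀ {f f′ g g′} → f ≈ f′ → g ≈ g′ → f + g ≈ f′ + g′
    +-cong p q = mk≈ λ k → K.+-cong (coeff-≈ p k) (coeff-≈ q k)

    +-identityˡ : ∀ f → 0# + f ≈ f
    +-identityˡ f = mk≈ λ k → K.trans (K.+-congʳ (coeff-0# k)) (K.+-identityˡ (coeff f k))

    -‿inverseˡ : ∀ f → - f + f ≈ 0#
    -‿inverseˡ f = mk≈ λ k → K.trans (K.-‿inverseˡ (coeff f k)) (K.sym (coeff-0# k))

  isCommutativeRing : IsCommutativeRing _≈_ _+_ _*_ -_ 0# 1#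
  isCommutativeRing = record
    { isRing = record
      { +-isAbelianGroup = record
        { isGroup = record
          { isMonoid = record
            { isSemigroup = record
              { isMagma = record
                { isEquivalence = record
                  { refl  = mk≈ λ _ → K.refl
                  ; sym   = λ p → mk≈ λ k → K.sym (coeff-≈ p k)
                  ; trans = ≈-trans
                  }
                ; ∙-cong = +-cong
                }
              ; assoc = λ f g h → mk≈ λ k → K.+-assoc (coeff f k) (coeff g k) (coeff h k)
              }
            ; identity = +-identityˡ , λ f → ≈-trans (+-comm f 0#) (+-identityˡ f)
            }
          ; inverse = -‿inverseˡ , λ f → ≈-trans (+-comm f (- f)) (-‿inverseˡ f)
          ; ⁻¹-cong = λ p → mk≈ λ k → K.-‿cong (coeff-≈ p k)
          }
        ; comm = +-comm
        }
      ; *-cong = *-cong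
      ; *-assoc = *-assoc
      ; *-identity = *-identityˡ , λ f → ≈-trans (*-comm f 1#) (*-identityˡ f)
      ; distrib = (λ f g h → ≈-trans (*-comm f (g + h))
                    (≈-trans (*-distribʳ-+ f g h) (+-cong (*-comm g f) (*-comm h f))))
                , *-distribʳ-+
      }
    ; *-comm = *-comm
    }

  commutativeRing : CommutativeRing (c ⊔ ℓ₁) ℓ₁
  commutativeRing = record { isCommutativeRing = isCommutativeRing }

-- Inverses of Laurent series, and the dilation `σ` as a ring homomorphism.

module FieldOperations {c ℓ₁ ℓ₂} (K : HeytingField c ℓ₁ ℓ₂) where

  open LaurentSeries K
  open LaurentRing K

  private
    module K where
      open HeytingField K public using (_#_; #⇒invertible)
      open CommutativeRing coefficientRing public
      open import Algebra.Properties.Ring ring public using (-0#≈0#; -‿distribʳ-*)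
      open import Algebra.Properties.Monoid.Sum +-monoid public using (sum; sum-cong-≋)
      open SetoidReasoning setoid public

  open CauchyProduct coefficientRing
  open HasSeries

  inv-inverseʳ : ∀ a a#0 → a K.* inv a a#0 K.≈ K.1#
  inv-inverseʳ a a#0 = K.trans
    -- Apartness of `a` from zero provides an inverse of `a - 0#`, not literally of `a`.
    (K.*-congʳ (K.sym (K.trans (K.+-congˡ K.-0#≈0#) (K.+-identityʳ a))))
    (proj₂ (proj₂ (K.#⇒invertible a#0)))

  module _ (u : ℕ → K.Carrier) (w : K.Carrier) (uw≈1 : u 0 K.* w K.≈ K.1#) where

    open PowerSeriesInverse u w

    -- Lets the sum in the recursion for `v` be recognised as part of a Cauchy product.
    previous-v : ∀ k (i : Fin (suc k)) → previous (suc k) i ≡ v (k ∸ toℕ i)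
    previous-v k       zero    = ≡.refl
    previous-v (suc k) (suc i) = previous-v k i

    -- The recursion sets `v (suc k)` to `- (w * S)`, where `S` is the sum of all other terms of the
    -- product; since `w` inverts `u 0`, the first term becomes `- S`.
    ⋆-inverseʳ : u ⋆ v ≋ unit
    ⋆-inverseʳ zero    = K.trans (K.+-identityʳ (u 0 K.* w)) uw≈1
    ⋆-inverseʳ (suc k) = begin
      u 0 K.* (K.- (w K.* S)) K.+ ((u ∘ suc) ⋆ v) k
        ≈⟨ K.+-cong (K.sym (K.-‿distribʳ-* (u 0) (w K.* S)))
             (K.sum-cong-≋ {suc k} λ i →
               K.*-congˡ {u (suc (toℕ i))} (K.reflexive (≡.sym (previous-v k i)))) ⟩
      K.- (u 0 K.* (w K.* S)) K.+ S
        ≈⟨ K.+-congʳ (K.-‿cong (K.trans (K.sym (K.*-assoc (u 0) w S))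
             (K.trans (K.*-congʳ uw≈1) (K.*-identityˡ S)))) ⟩
      K.- S K.+ S ≈⟨ K.-‿inverseˡ S ⟩
      K.0# ∎
      where
      open K using (begin_; _∎; step-≈-⟩)
      S : K.Carrier
      S = K.sum {suc k} λ i → u (suc (toℕ i)) K.* previous (suc k) i

  -- Read from its leading exponent `n` instead of `lower f`, the series is x^n times a power series
  -- with invertible constant term, and the starts `n` and `- n` cancel.
  1/-inverseˡ : ∀ f f≠0 → 1/ f f≠0 * f ≈ 1#
  1/-inverseˡ f f≠0@(n , fₙ#0 , f<n≈0) = hasSeries⇒≈
    (reindex (ℤₚ.+-inverseˡ n)
      (*-hasSeries {g = f} {v = u} (series-hasSeries (ℤ.- n) v)
        (hasSeries (λ {k} → f<n≈0 k) λ _ → K.refl)))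
    (series-hasSeries (+ 0) unit)
    λ m → K.trans (⋆-comm v u m) (⋆-inverseʳ u w uw≈1 m)
    where
    u : ℕ → K.Carrier
    u m = coeff f (n ℤ.+ + m)
    w : K.Carrier
    w = inv (coeff f n) fₙ#0
    uw≈1 : u 0 K.* w K.≈ K.1#
    uw≈1 = K.trans (K.*-congʳ (K.reflexive (≡.cong (coeff f) (ℤₚ.+-identityʳ n))))
      (inv-inverseʳ (coeff f n) fₙ#0)
    open PowerSeriesInverse u w

  module _ (q : K.Carrier) (q#0 : q K.# K.0#) where

    private
      p : ℤ → K.Carrier
      p = power q q#0

      q⁻¹ : K.Carrier
      q⁻¹ = inv q q#0

      open SetoidReasoning K.setoid
      open RawSemiringDefs (Semiring.rawSemiring K.semiring) using () renaming (_^_ to _^ᴷ_)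
      open SemiringSolver K.commutativeSemiring using (solve; _:=_; _:*_)

      cancel : ∀ x → q K.* (q⁻¹ K.* x) K.≈ x
      cancel x = K.trans (K.sym (K.*-assoc q q⁻¹ x))
        (K.trans (K.*-congʳ (inv-inverseʳ q q#0)) (K.*-identityˡ x))

    power-suc : ∀ k → p (ℤ.suc k) K.≈ q K.* p k
    power-suc (+ n)          = K.refl
    power-suc -[1+ zero ]    = K.sym (cancel K.1#)
    power-suc -[1+ suc n ]   = K.sym (cancel (p -[1+ n ]))

    power-+-nonneg : ∀ m k → p (+ m ℤ.+ k) K.≈ p (+ m) K.* p k
    power-+-nonneg zero    k = K.trans (K.reflexive (≡.cong p (ℤₚ.+-identityˡ k)))
      (K.sym (K.*-identityˡ (p k)))
    power-+-nonneg (suc m) k = begin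
      p (+ suc m ℤ.+ k)         ≈⟨ K.reflexive (≡.cong p (ℤₚ.suc-+ m k)) ⟩
      p (ℤ.suc (+ m ℤ.+ k))     ≈⟨ power-suc (+ m ℤ.+ k) ⟩
      q K.* p (+ m ℤ.+ k)       ≈⟨ K.*-congˡ (power-+-nonneg m k) ⟩
      q K.* (p (+ m) K.* p k)   ≈⟨ K.*-assoc q (p (+ m)) (p k) ⟨
      p (+ suc m) K.* p k       ∎

    q*-injective : ∀ {x y} → q K.* x K.≈ q K.* y → x K.≈ y
    q*-injective {x} {y} eq = K.trans (K.sym (flip-cancel x))
      (K.trans (K.*-congˡ eq) (flip-cancel y))
      where
      flip-cancel : ∀ z → q⁻¹ K.* (q K.* z) K.≈ z
      flip-cancel z = K.trans (solve 3 (λ a b c → a :* (b :* c) := b :* (a :* c)) K.refl q⁻¹ q z)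
        (cancel z)

    -- For negative `i`, multiplying both sides by the cancellable `q` moves the exponent one step
    -- towards zero, so the induction ends at the nonnegative case.
    power-+ : ∀ i k → p (i ℤ.+ k) K.≈ p i K.* p k
    power-+ (+ m)        k = power-+-nonneg m k
    power-+ (-[1+ m ]) k = q*-injective (begin
      q K.* p (-[1+ m ] ℤ.+ k)         ≈⟨ power-suc (-[1+ m ] ℤ.+ k) ⟨
      p (ℤ.suc (-[1+ m ] ℤ.+ k))       ≈⟨ K.reflexive (≡.cong p (≡.sym (ℤₚ.+-assoc (+ 1) -[1+ m ] k))) ⟩
      p (ℤ.suc -[1+ m ] ℤ.+ k)         ≈⟨ ih m ⟩
      p (ℤ.suc -[1+ m ]) K.* p k       ≈⟨ K.*-congʳ (power-suc -[1+ m ]) ⟩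
      q K.* p -[1+ m ] K.* p k         ≈⟨ K.*-assoc q (p -[1+ m ]) (p k) ⟩
      q K.* (p -[1+ m ] K.* p k)       ∎)
      where
      ih : ∀ m → p (ℤ.suc -[1+ m ] ℤ.+ k) K.≈ p (ℤ.suc -[1+ m ]) K.* p k
      ih zero    = power-+ (+ 0) k
      ih (suc m) = power-+ -[1+ m ] k

    private
      σ′ : Operator
      σ′ = σ q q#0

    -- Splitting q^(N+m) isolates the possibly negative exponent in a constant and leaves natural
    -- powers, to which `⋆-dilate` applies.
    σ-hasSeries : ∀ {f N u} → HasSeries f N u →
                  HasSeries (σ′ f) N (λ m → p N K.* (q ^ᴷ m K.* u m))
    σ-hasSeries {N = N} F = hasSeries
      (λ k<N → K.trans (K.*-congˡ (vanishes F k<N)) (K.zeroʳ _))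
      λ m → K.trans (K.*-cong (power-+ N (+ m)) (at F m)) (K.*-assoc _ _ _)

    σ-* : ∀ f g → σ′ (f * g) ≈ σ′ f * σ′ g
    σ-* f g = hasSeries⇒≈
      (σ-hasSeries (*-hasSeries F G))
      (*-hasSeries (σ-hasSeries F) (σ-hasSeries G))
      λ m → begin
        p (N ℤ.+ M) K.* (q ^ᴷ m K.* (u ⋆ v) m)
          ≈⟨ K.*-congʳ (power-+ N M) ⟩
        p N K.* p M K.* (q ^ᴷ m K.* (u ⋆ v) m)
          ≈⟨ K.*-assoc (p N) (p M) _ ⟩
        p N K.* (p M K.* (q ^ᴷ m K.* (u ⋆ v) m))
          ≈⟨ K.*-congˡ (K.*-congˡ (⋆-dilate q u v m)) ⟨
        p N K.* (p M K.* ((λ i → q ^ᴷ i K.* u i) ⋆ (λ i → q ^ᴷ i K.* v i)) m)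
          ≈⟨ ⋆-scale (p N) (p M) (λ i → q ^ᴷ i K.* u i) (λ i → q ^ᴷ i K.* v i) m ⟨
        ((λ i → p N K.* (q ^ᴷ i K.* u i)) ⋆ (λ i → p M K.* (q ^ᴷ i K.* v i))) m ∎
      where
      N M : ℤ
      N = lower f
      M = lower g
      u v : ℕ → K.Carrier
      u = lowerSeries f
      v = lowerSeries g
      F = lower-hasSeries f
      G = lower-hasSeries g

    σ-1# : σ′ 1# ≈ 1#
    σ-1# = hasSeries⇒≈ (σ-hasSeries unit-hasSeries) unit-hasSeries λ where
        zero    → K.trans (K.*-identityˡ _) (K.*-identityˡ K.1#)
        (suc m) → K.trans (K.*-identityˡ _) (K.zeroʳ _)
      where
      unit-hasSeries : HasSeries 1# (+ 0) unit
      unit-hasSeries = series-hasSeries (+ 0) unit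

    open RingMorphisms (CommutativeRing.rawRing commutativeRing) (CommutativeRing.rawRing commutativeRing)
      using (IsRingHomomorphism)

    σ-isRingHomomorphism : IsRingHomomorphism σ′
    σ-isRingHomomorphism = record
      { isSemiringHomomorphism = record
        { isNearSemiringHomomorphism = record
          { +-isMonoidHomomorphism = record
            { isMagmaHomomorphism = record
              { isRelHomomorphism = record { cong = λ f≈g → mk≈ λ k → K.*-congˡ (coeff-≈ f≈g k) }
              ; homo = λ f g → mk≈ λ k → K.distribˡ (p k) (coeff f k) (coeff g k)
              }
            ; ε-homo = mk≈ λ k → K.trans (K.*-congˡ (coeff-0# k))
                (K.trans (K.zeroʳ (p k)) (K.sym (coeff-0# k)))
            }
          ; *-homo = σ-*
          }
        ; 1#-homo = σ-1#
        }
      ; -‿homo = λ f → mk≈ λ k → K.sym (K.-‿distribʳ-* (p k) (coeff f k))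
      }

-- Complete homogeneous symmetric polynomials.

module CompleteHomogeneous {c ℓ} (R : CommutativeRing c ℓ) where

  open CommutativeRing R hiding (zero)
  open import Algebra.Properties.Ring ring using (+-cancelˡ; -1*x≈-x)
  open RawSemiringDefs (Semiring.rawSemiring semiring) using (_^_)
  open SetoidReasoning setoid
  open SemiringSolver commutativeSemiring using (solve; _:=_; _:+_; _:*_)

  -- The complete homogeneous symmetric polynomial of degree m in a 0, …, a (j - 1).
  h : (ℕ → Carrier) → ℕ → ℕ → Carrier
  h a j       zero    = 1#
  h a zero    (suc m) = 0#
  h a (suc j) (suc m) = a 0 * h a (suc j) m + h (a ∘ suc) j (suc m)

  -- The definition peels off the first variable. Symmetry is needed only in this form, which peels
  -- off the last one.
  h-last : ∀ a j m → h a (suc j) (suc m) ≈ a j * h a (suc j) m + h a j (suc m)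
  h-last a zero    m    = refl
  h-last a (suc j) zero = trans (+-congˡ (h-last (a ∘ suc) j zero))
    (solve 3 (λ x y z → x :+ (y :+ z) := y :+ (x :+ z)) refl
      (a 0 * 1#) (a (suc j) * 1#) (h (a ∘ suc) j 1))
  h-last a (suc j) (suc m) = trans
    (+-cong (*-congˡ (h-last a (suc j) m)) (h-last (a ∘ suc) j (suc m)))
    (solve 6 (λ x y p q r s → x :* (y :* p :+ q) :+ (y :* r :+ s) := y :* (x :* p :+ r) :+ (x :* q :+ s))
      refl (a 0) (a (suc j)) (h a (2 ℕ.+ j) m) (h a (suc j) (suc m))
      (h (a ∘ suc) (suc j) (suc m)) (h (a ∘ suc) j (2 ℕ.+ m)))

  h-single : ∀ a m → h a 1 m ≈ a 0 ^ m
  h-single a zero    = refl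
  h-single a (suc m) = trans (+-identityʳ _) (*-congˡ (h-single a m))

  -- Compares the expansions of `h a (suc j) (suc m)` by its first variable, which holds by
  -- definition, and by its last. Giving a_j - a_0 as `d` with `d + a 0 ≈ a j` keeps subtraction
  -- out, so a semiring solver suffices.
  h-difference : ∀ a j m d → d + a 0 ≈ a j → h (a ∘ suc) j (suc m) ≈ d * h a (suc j) m + h a j (suc m)
  h-difference a j m d d+a₀≈aⱼ = +-cancelˡ (a 0 * H) _ _ (begin
    a 0 * H + h (a ∘ suc) j (suc m)          ≈⟨ h-last a j m ⟩
    a j * H + h a j (suc m)                  ≈⟨ +-congʳ (*-congʳ d+a₀≈aⱼ) ⟨
    (d + a 0) * H + h a j (suc m)
      ≈⟨ solve 4 (λ d x p q → (d :+ x) :* p :+ q := x :* p :+ (d :* p :+ q)) refl d (a 0) H _ ⟩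
    a 0 * H + (d * H + h a j (suc m))        ∎)
    where
    H : Carrier
    H = h a (suc j) m

  module _ (σ : Carrier → Carrier)
           (σ-hom : RingMorphisms.IsRingHomomorphism rawRing rawRing σ) where

    open RingMorphisms.IsRingHomomorphism σ-hom

    -- By homogeneity, `α ^ m` supplies one `α` to each of the `m` variables in a monomial, and each
    -- then yields one sign. The target `b` is kept general so that the induction can shift both
    -- sequences.
    σ-h : ∀ α a b → (∀ i → α * σ (a i) ≈ - b i) →
          ∀ j m → α ^ m * σ (h a j m) ≈ (- 1#) ^ m * h b j m
    σ-h α a b p j zero = *-congˡ 1#-homo
    σ-h α a b p zero (suc m) = trans (trans (*-congˡ 0#-homo) (zeroʳ _)) (sym (zeroʳ _))
    σ-h α a b p (suc j) (suc m) = begin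
      α * α ^ m * σ (a 0 * h a (suc j) m + h (a ∘ suc) j (suc m))
        ≈⟨ *-congˡ (trans (+-homo _ _) (+-congʳ (*-homo _ _))) ⟩
      α * α ^ m * (σ (a 0) * σ (h a (suc j) m) + σ (h (a ∘ suc) j (suc m)))
        ≈⟨ solve 5 (λ α β x y z → α :* β :* (x :* y :+ z) := α :* x :* (β :* y) :+ α :* β :* z)
             refl α (α ^ m) (σ (a 0)) _ _ ⟩
      α * σ (a 0) * (α ^ m * σ (h a (suc j) m)) + α ^ suc m * σ (h (a ∘ suc) j (suc m))
        ≈⟨ +-cong (*-cong (trans (p 0) (sym (-1*x≈-x (b 0)))) (σ-h α a b p (suc j) m))
             (σ-h α (a ∘ suc) (b ∘ suc) (p ∘ suc) j (suc m)) ⟩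
      - 1# * b 0 * ((- 1#) ^ m * h b (suc j) m) + (- 1#) ^ suc m * h (b ∘ suc) j (suc m)
        ≈⟨ solve 5 (λ e f x y z → e :* x :* (f :* y) :+ e :* f :* z := e :* f :* (x :* y :+ z))
             refl (- 1#) ((- 1#) ^ m) (b 0) _ _ ⟩
      (- 1#) ^ suc m * h b (suc j) (suc m) ∎

    -- One descent in degree. The constant `c` stands for the accumulated sign, which passes through
    -- the operator because `σ` fixes it.
    operator-h : ∀ α a → (∀ i → α * σ (a i) ≈ - a (suc i)) →
                 ∀ j m d e c → d + a 0 ≈ a j → e * d ≈ 1# → σ c ≈ c →
                 e * (α ^ suc m * σ (c * h a j (suc m)) + - ((- 1#) ^ suc m * (c * h a j (suc m)))) ≈
                 c * (- 1#) ^ suc m * h a (suc j) m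
    operator-h α a p j m d e c d+a₀≈aⱼ ed≈1 σc≈c = begin
      e * (α ^ suc m * σ (c * X) + - (s * (c * X)))
        ≈⟨ *-congˡ (+-congʳ (*-congˡ (trans (*-homo c X) (*-congʳ σc≈c)))) ⟩
      e * (α ^ suc m * (c * σ X) + - (s * (c * X)))
        ≈⟨ *-congˡ (+-congʳ (solve 3 (λ x y z → x :* (y :* z) := y :* (x :* z)) refl _ c (σ X))) ⟩
      e * (c * (α ^ suc m * σ X) + - (s * (c * X)))
        ≈⟨ *-congˡ (+-congʳ (*-congˡ (σ-h α a (a ∘ suc) p j (suc m)))) ⟩
      e * (c * (s * h (a ∘ suc) j (suc m)) + - (s * (c * X)))
        ≈⟨ *-congˡ (+-congʳ (*-congˡ (*-congˡ (h-difference a j m d d+a₀≈aⱼ)))) ⟩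
      e * (c * (s * (d * H + X)) + - (s * (c * X)))
        -- Regrouped so that the summand free of `d` is exactly the one subtracted; `e` then cancels
        -- `d` in what survives.
        ≈⟨ *-congˡ (+-congʳ (solve 5
             (λ c s d h x → c :* (s :* (d :* h :+ x)) := d :* (c :* s :* h) :+ s :* (c :* x))
             refl c s d H X)) ⟩
      e * (d * (c * s * H) + s * (c * X) + - (s * (c * X)))
        ≈⟨ *-congˡ (trans (+-assoc _ _ _) (trans (+-congˡ (-‿inverseʳ _)) (+-identityʳ _))) ⟩
      e * (d * (c * s * H))
        ≈⟨ trans (sym (*-assoc e d _)) (trans (*-congʳ ed≈1) (*-identityˡ _)) ⟩
      c * s * H ∎
      where
      X H s : Carrier
      X = h a j (suc m)
      H = h a (suc j) m
      s = (- 1#) ^ suc m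

-- Bookkeeping of signs.

module Signs {c ℓ} (R : CommutativeRing c ℓ) where

  open CommutativeRing R hiding (zero)
  open import Algebra.Properties.Ring ring using (-1*x≈-x; -‿involutive)
  open RawSemiringDefs (Semiring.rawSemiring semiring) using (_^_)
  open import Algebra.Properties.Semiring.Exp semiring using (^-homo-*; ^-congʳ)
  open SetoidReasoning setoid
  open SemiringSolver commutativeSemiring using (solve; _:=_; _:*_)

  -- The sign (-1)^(k(k+1)/2) contributed by the `k` leftmost factors of the operator, kept as a
  -- product so that each factor changes it by one step.
  sgn : ℕ → Carrier
  sgn zero    = 1#
  sgn (suc k) = sgn k * (- 1#) ^ suc k

  -1^m*-1^m≈1 : ∀ m → (- 1#) ^ m * (- 1#) ^ m ≈ 1#
  -1^m*-1^m≈1 zero    = *-identityˡ 1#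
  -1^m*-1^m≈1 (suc m) = begin
    - 1# * (- 1#) ^ m * (- 1# * (- 1#) ^ m)
      ≈⟨ solve 2 (λ e f → e :* f :* (e :* f) := e :* e :* (f :* f)) refl (- 1#) _ ⟩
    - 1# * - 1# * ((- 1#) ^ m * (- 1#) ^ m)
      ≈⟨ *-cong (trans (-1*x≈-x (- 1#)) (-‿involutive 1#)) (-1^m*-1^m≈1 m) ⟩
    1# * 1# ≈⟨ *-identityˡ 1# ⟩
    1# ∎

  cancel-sign : ∀ x m → x * (- 1#) ^ m * (- 1#) ^ m ≈ x
  cancel-sign x m = trans (*-assoc x _ _) (trans (*-congˡ (-1^m*-1^m≈1 m)) (*-identityʳ x))

  triangle-suc : ∀ n → suc n ℕ.* n / 2 ≡ n ℕ.* (n ∸ 1) / 2 ℕ.+ n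
  triangle-suc n = ≡.trans (≡.cong (_/ 2) (expand n))
    (≡.trans (+-distrib-/-∣ʳ (n ℕ.* (n ∸ 1)) (n∣m*n n))
      (≡.cong (n ℕ.* (n ∸ 1) / 2 ℕ.+_) (m*n/n≡m n 2)))
    where
    open ℕ-Solver using () renaming (solve to solveℕ; con to conℕ; _:=_ to _⊜_; _:+_ to _⊕_; _:*_ to _⊗_)
    expand : ∀ n → suc n ℕ.* n ≡ n ℕ.* (n ∸ 1) ℕ.+ n ℕ.* 2
    -- Truncated subtraction makes `n ∸ 1` zero here; for successors it disappears and the solver
    -- applies.
    expand zero    = ≡.refl
    expand (suc n) = solveℕ 1 (λ n → (conℕ 2 ⊕ n) ⊗ (conℕ 1 ⊕ n) ⊜
      (conℕ 1 ⊕ n) ⊗ n ⊕ (conℕ 1 ⊕ n) ⊗ conℕ 2) ≡.refl n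

  -- The exponents n(n+1)/2 + n and n(n-1)/2 differ by the even number 2n.
  sgn*-1^n : ∀ n → sgn n * (- 1#) ^ n ≈ (- 1#) ^ (n ℕ.* (n ∸ 1) / 2)
  sgn*-1^n zero    = *-identityˡ 1#
  sgn*-1^n (suc n) = begin
    sgn n * (- 1#) ^ suc n * (- 1#) ^ suc n           ≈⟨ cancel-sign (sgn n) (suc n) ⟩
    -- A pair of equal signs is inserted to reach the induction hypothesis.
    sgn n                                             ≈⟨ cancel-sign (sgn n) n ⟨
    sgn n * (- 1#) ^ n * (- 1#) ^ n                   ≈⟨ *-congʳ (sgn*-1^n n) ⟩
    (- 1#) ^ (n ℕ.* (n ∸ 1) / 2) * (- 1#) ^ n         ≈⟨ ^-homo-* (- 1#) (n ℕ.* (n ∸ 1) / 2) n ⟨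
    (- 1#) ^ (n ℕ.* (n ∸ 1) / 2 ℕ.+ n)                ≈⟨ ^-congʳ (- 1#) (≡.sym (triangle-suc n)) ⟩
    (- 1#) ^ (suc n ℕ.* n / 2)                        ∎

  module _ (σ : Carrier → Carrier)
           (σ-hom : RingMorphisms.IsRingHomomorphism rawRing rawRing σ) where

    open RingMorphisms.IsRingHomomorphism σ-hom

    σ-sign : ∀ m → σ ((- 1#) ^ m) ≈ (- 1#) ^ m
    σ-sign zero    = 1#-homo
    σ-sign (suc m) = trans (*-homo _ _)
      (*-cong (trans (-‿homo 1#) (-‿cong 1#-homo)) (σ-sign m))

    σ-sgn : ∀ k → σ (sgn k) ≈ sgn k
    σ-sgn zero    = 1#-homo
    σ-sgn (suc k) = trans (*-homo _ _) (*-cong (σ-sgn k) (σ-sign (suc k)))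

-- The operator product over a commutative ring with an endomorphism.

module Factorisation {c ℓ} (R : CommutativeRing c ℓ)
    (σ : CommutativeRing.Carrier R → CommutativeRing.Carrier R)
    (σ-hom : RingMorphisms.IsRingHomomorphism (CommutativeRing.rawRing R) (CommutativeRing.rawRing R) σ)
  where

  open CommutativeRing R hiding (zero)
  open RingMorphisms.IsRingHomomorphism σ-hom
  open import Algebra.Properties.Ring ring
    using (-1*x≈-x; -‿distribˡ-*; -‿distribʳ-*; +-inverseˡ-unique)
  open import Algebra.Properties.CommutativeSemiring.Exp commutativeSemiring
    using (^-distrib-*; ^-congˡ)
  open RawSemiringDefs (Semiring.rawSemiring semiring) using (_^_; sum)
  open CompleteHomogeneous R
  open Signs R
  open SetoidReasoning setoid
  open SemiringSolver commutativeSemiring using (solve; _:=_; _:+_; _:*_)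

  -- Telescoping: `foldr` applies the last operator first, so the states run from `S n` down to
  -- `S 0`.
  foldr-chain : ∀ {n} (T : Vector (Carrier → Carrier) n) (S : ℕ → Carrier) →
                (∀ i {g g′} → g ≈ g′ → T i g ≈ T i g′) →
                (∀ i → T i (S (suc (toℕ i))) ≈ S (toℕ i)) →
                ∀ {g} → g ≈ S n → foldr _∘′_ id T g ≈ S 0
  foldr-chain {zero}  T S T-cong step g≈ = g≈
  foldr-chain {suc n} T S T-cong step g≈ = trans
    (T-cong zero (foldr-chain (T ∘ suc) (S ∘ suc) (λ i → T-cong (suc i)) (λ i → step (suc i)) g≈))
    (step zero)

  module _ (α β f : Carrier) (equation : α * σ f + f ≈ β) where

    open Function.Endo.Propositional Carrier using () renaming (_^_ to _^ᵒ_)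

    private
      A : Carrier → Carrier
      A g = - α * σ g

    A-sum : ∀ {n} (t : Vector Carrier n) → sum (A ∘ t) ≈ A (sum t)
    A-sum {zero}  t = sym (trans (*-congˡ 0#-homo) (zeroʳ (- α)))
    A-sum {suc n} t = sym (begin
      - α * σ (t zero + sum (t ∘ suc))            ≈⟨ *-congˡ (+-homo _ _) ⟩
      - α * (σ (t zero) + σ (sum (t ∘ suc)))      ≈⟨ distribˡ (- α) _ _ ⟩
      A (t zero) + A (sum (t ∘ suc))              ≈⟨ +-congˡ (A-sum (t ∘ suc)) ⟨
      A (t zero) + sum (A ∘ t ∘ suc)              ∎)

    -- Has the same shape as `βₛ`, so that the two agree by computation for Laurent series.
    b : ℕ → Carrier
    b j = sum {j} λ k → (A ^ᵒ toℕ k) β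

    -- The terms after the first are `A` applied to those of `b j`, and `A` is additive.
    b-suc : ∀ j → b (suc j) ≈ β + - (α * σ (b j))
    b-suc j = +-congˡ (trans (A-sum {j} (λ k → (A ^ᵒ toℕ k) β)) (sym (-‿distribˡ-* α (σ (b j)))))

    a : ℕ → Carrier
    a j = b j + - f

    -- The recursion sends `b j` to `b (suc j)` by the affine map g ↦ β - α σ g, of which `f` is a
    -- fixed point by `equation`; the constant `β` drops out of the difference.
    σ-a : ∀ j → α * σ (a j) ≈ - a (suc j)
    σ-a j = +-inverseˡ-unique _ _ (begin
      α * σ (b j + - f) + (b (suc j) + - f)
        ≈⟨ +-cong
             (trans (*-congˡ (trans (+-homo _ _) (+-congˡ (-‿homo f))))
               (trans (distribˡ α _ _) (+-congˡ (sym (-‿distribʳ-* α (σ f))))))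
             (+-congʳ (trans (b-suc j) (+-congʳ (sym equation)))) ⟩
      X + - Y + (Y + f + - X + - f)
        -- Negatives enter the semiring solver as independent variables.
        ≈⟨ solve 6 (λ x x′ y y′ z z′ →
             x :+ y′ :+ (y :+ z :+ x′ :+ z′) := (x :+ x′) :+ (y :+ y′) :+ (z :+ z′))
             refl X (- X) Y (- Y) f (- f) ⟩
      (X + - X) + (Y + - Y) + (f + - f)
        ≈⟨ +-cong (+-cong (-‿inverseʳ X) (-‿inverseʳ Y)) (-‿inverseʳ f) ⟩
      0# + 0# + 0#
        ≈⟨ trans (+-identityʳ _) (+-identityʳ 0#) ⟩
      0# ∎)
      where
      X Y : Carrier
      X = α * σ (b j)
      Y = α * σ f

    module _ (n : ℕ) (e : Fin n → Carrier) (eb≈1 : ∀ k → e k * b (n ∸ toℕ k) ≈ 1#) where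

      private
        -- The final value, built into every remainder: h_n(a_0) is (-1)^n f^n, and `s₀ * sgn n`
        -- cancels this sign because `s₀` squares to one.
        s₀ : Carrier
        s₀ = (- 1#) ^ (n ℕ.* (n ∸ 1) / 2)

      T : Fin n → Carrier → Carrier
      T k g = e k * (α ^ suc (toℕ k) * σ g + - ((- 1#) ^ suc (toℕ k) * g))

      -- What remains of f^n when only the k leftmost factors are still to be applied.
      remainder : ℕ → Carrier
      remainder k = s₀ * sgn k * h a (suc (n ∸ k)) k

      T-cong : ∀ i {g g′} → g ≈ g′ → T i g ≈ T i g′
      T-cong i g≈g′ = *-congˡ (+-cong (*-congˡ (⟦⟧-cong g≈g′)) (-‿cong (*-congˡ g≈g′)))

      -- With `k = toℕ i`, the factor lowers the degree from `suc k` to `k` and raises the number of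
      -- variables from `n ∸ k` by one; its divisor `b (n ∸ k)` is the difference between the new
      -- variable and `a 0`.
      T-remainder : ∀ i → T i (remainder (suc (toℕ i))) ≈ remainder (toℕ i)
      T-remainder i = begin
        T i (s₁ * h a (suc (n ∸ suc k)) (suc k))
          -- `suc (n ∸ suc k)` equals `n ∸ k` only because `k` is less than `n`.
          ≡⟨ ≡.cong (λ j → T i (s₁ * h a j (suc k))) (≡.sym (ℕₚ.+-∸-assoc 1 (toℕ<n i))) ⟩
        T i (s₁ * h a (n ∸ k) (suc k))
          ≈⟨ operator-h σ σ-hom α a σ-a (n ∸ k) k (b (n ∸ k)) (e i) s₁
               -- `b 0` is the empty sum, so `a 0` is `0# + - f`.
               (+-congˡ (+-identityˡ (- f))) (eb≈1 i)
               (trans (*-homo _ _)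
                 (*-cong (σ-sign σ σ-hom (n ℕ.* (n ∸ 1) / 2)) (σ-sgn σ σ-hom (suc k)))) ⟩
        s₁ * (- 1#) ^ suc k * h a (suc (n ∸ k)) k
          ≈⟨ *-congʳ (trans (*-assoc s₀ _ _) (*-congˡ (cancel-sign (sgn k) (suc k)))) ⟩
        remainder k ∎
        where
        k : ℕ
        k = toℕ i
        s₁ : Carrier
        s₁ = s₀ * sgn (suc k)

      f^n≈remainder : f ^ n ≈ remainder n
      f^n≈remainder = sym (begin
        s₀ * sgn n * h a (suc (n ∸ n)) n
          ≡⟨ ≡.cong (λ j → s₀ * sgn n * h a (suc j) n) (ℕₚ.n∸n≡0 n) ⟩
        s₀ * sgn n * h a 1 n
          ≈⟨ *-congˡ (trans (h-single a n) (^-congˡ n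
               (trans (+-identityˡ (- f)) (sym (-1*x≈-x f))))) ⟩
        s₀ * sgn n * (- 1# * f) ^ n
          ≈⟨ *-congˡ (^-distrib-* (- 1#) f n) ⟩
        s₀ * sgn n * ((- 1#) ^ n * f ^ n)
          ≈⟨ solve 4 (λ s t u v → s :* t :* (u :* v) := s :* (t :* u) :* v) refl
               s₀ (sgn n) ((- 1#) ^ n) (f ^ n) ⟩
        s₀ * (sgn n * (- 1#) ^ n) * f ^ n
          -- `sgn n * (- 1#) ^ n` is `s₀` once more, and the two copies cancel.
          ≈⟨ *-congʳ (trans (*-congˡ (sgn*-1^n n)) (-1^m*-1^m≈1 (n ℕ.* (n ∸ 1) / 2))) ⟩
        1# * f ^ n
          ≈⟨ *-identityˡ (f ^ n) ⟩
        f ^ n ∎)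

      foldr-T-f^n : foldr _∘′_ id T (f ^ n) ≈ s₀
      foldr-T-f^n = trans (foldr-chain T remainder T-cong T-remainder f^n≈remainder)
        -- `remainder 0` computes to `s₀ * 1# * 1#`.
        (trans (*-identityʳ (s₀ * 1#)) (*-identityʳ s₀))

-- Specialisation to Laurent series.

module _ {c ℓ₁ ℓ₂} (K : HeytingField c ℓ₁ ℓ₂) where

  open HeytingField K using (Carrier; _#_) renaming (0# to 0ᴷ)
  open LaurentSeries K
  open LaurentRing K using (commutativeRing)
  open FieldOperations K using (1/-inverseˡ; σ-isRingHomomorphism)

  -- The factors of `L` are by computation the operators `T` whose `e k` is the series inverse of
  -- β_{n-k}.
  L-f^n : (q : Carrier) (q#0 : q # 0ᴷ) (n : ℕ) (α β f : Laurent) →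
          α * σ q q#0 f + f ≈ β →
          (βⱼ≠0 : ∀ j → 0 ℕ.< j → j ℕ.≤ n → βₛ q q#0 α β j ≠0) →
          L q q#0 n α β βⱼ≠0 (f ^ n) ≈ (- 1#) ^ (n ℕ.* (n ∸ 1) / 2)
  L-f^n q q#0 n α β f equation βⱼ≠0 =
    Factorisation.foldr-T-f^n commutativeRing (σ q q#0) (σ-isRingHomomorphism q q#0)
      α β f equation n (λ k → 1/ (βₛ q q#0 α β (n ∸ toℕ k)) (nonzero k))
      λ k → 1/-inverseˡ (βₛ q q#0 α β (n ∸ toℕ k)) (nonzero k)
    where
    -- The inverse depends on this witness, so it repeats the bounds used in `factor` verbatim.
    nonzero : ∀ k → βₛ q q#0 α β (n ∸ toℕ k) ≠0
    nonzero k = βⱼ≠0 (n ∸ toℕ k) (ℕₚ.m<n⇒0<n∸m (toℕ<n k)) (ℕₚ.m∸n≤m n (toℕ k))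

open import Defs

theorem2 : (q : ℂ) (q≠0 : q #ℂ 0ℂ) (n : ℕ) → 0 ℕ.< n →
    (α β f : Laurent) → α ≠0 → β ≠0 →
    α * σ q q≠0 f + f ≈ β →
    (βⱼ≠0 : ∀ j → 0 ℕ.< j → j ℕ.≤ n → βₛ q q≠0 α β j ≠0) →
    L q q≠0 n α β βⱼ≠0 (f ^ n) ≈ (- 1#) ^ (n ℕ.* (n ∸ 1) / 2)
theorem2 q q≠0 n _ α β f _ _ = L-f^n ℂ-field q q≠0 n α β f
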